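{- Let $H$ be the graph on vertices $\{1,\dots,12\}$ with the 18 edges $12,23,34,45,56,16$; $\{1,7\},\{4,7\},\{2,8\},\{5,8\},\{3,9\},\{6,9\}$; $\{7,10\},\{8,11\},\{9,12\}$; $\{10,11\},\{10,12\},\{11,12\}$. If $A\in\mathcal{S}(H)$ and $\mathbf{m}(A)=(3,5,4)$, then $A$ does not have the SSP. The matrix $$B=\begin{pmatrix} 1 & -1 & 0 & 0 & 0 & -1 & \sqrt{2} & 0 & 0 & 0 & 0 & 0 \\ -1 & 1 & -1 & 0 & 0 & 0 & 0 & \sqrt{2} & 0 & 0 & 0 & 0 \\ 0 & -1 & 1 & -1 & 0 & 0 & 0 & 0 & \sqrt{2} & 0 & 0 & 0 \\ 0 & 0 & -1 & 1 & -1 & 0 & \sqrt{2} & 0 & 0 & 0 & 0 & 0 \\ 0 & 0 & 0 & -1 & 1 & -1 & 0 & \sqrt{2} & 0 & 0 & 0 & 0 \\ -1 & 0 & 0 & 0 & -1 & 1 & 0 & 0 & \sqrt{2} & 0 & 0 & 0 \\ \sqrt{2} & 0 & 0 & \sqrt{2} & 0 & 0 & -2 & 0 & 0 & 2 & 0 & 0 \\ 0 & \sqrt{2} & 0 & 0 & \sqrt{2} & 0 & 0 & -2 & 0 & 0 & 2 & 0 \\ 0 & 0 & \sqrt{2} & 0 & 0 & \sqrt{2} & 0 & 0 & -2 & 0 & 0 & 2 \\ 0 & 0 & 0 & 0 & 0 & 0 & 2 & 0 & 0 & 0 & 1 & 1 \\ 0 & 0 & 0 & 0 & 0 & 0 &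 0 & 2 & 0 & 1 & 0 & 1 \\ 0 & 0 & 0 & 0 & 0 & 0 & 0 & 0 & 2 & 1 & 1 & 0 \end{pmatrix}\in\mathcal{S}(H)$$ has spectrum $\{ -4,-4,-4,0,0,0,0,0,3,3,3,3\}$, $\mathbf{m}(B)=(3,5,4)$, and $B$ has the SMP.
   Context: All matrices are real and symmetric. For a graph $G$ on vertices $\{1,\dots,n\}$, $\mathcal{S}(G)$ is the set of real symmetric $n\times n$ matrices $A=[a_{ij}]$ such that, for $i\neq j$, $a_{ij}\ne 0$ if and only if $ij$ is an edge of $G$ (diagonal entries are free). If $A$ has distinct eigenvalues $\lambda_1<\dots<\lambda_q$ with multiplicities $m_1,\dots,m_q$, its ordered multiplicity list is $\mathbf{m}(A)=(m_1,\dots,m_q)$. Let $\circ$ be the entrywise product and $[A,X]=AX-XA$. $A$ has the Strong Spectral Property (SSP) if the only symmetric $X$ with $A\circ X=O$, $I\circ X=O$, $[A,X]=O$ is $X=O$. An $n\times n$ matrix $A$ has the Strong Multiplicity Property (SMP) if the only symmetric $X$ with $A\circ X=O$, $I\circ X=O$, $[A,X]=O$ and $\operatorname{tr}(A^iX)=0$ for $i=2,\dots,n-1$ is $X=O$. -}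

module Defs where

import Algebra.Definitions.RawMonoid as RawMonoidDefinitions
open import Algebra.Bundles using (CommutativeRing)
open import Algebra.Structures using (IsCommutativeRing)
open import Data.Bool.Base using (if_then_else_)
open import Data.Fin.Base using (Fin; toℕ) renaming (_<_ to _<ᶠ_)
open import Data.Fin.Properties using (_≟_)
open import Data.Integer.Base as ℤ using (+_)
import Data.Integer.Properties as ℤₚ
open import Data.List.Base as List using (List; []; _∷_)
open import Data.List.Membership.Propositional using (_∈_)
open import Data.List.Relation.Unary.All as All using (all?)
open import Data.Nat.Base as ℕ using (ℕ; zero; suc)
import Data.Nat.Properties as ℕₚ
open import Data.Product using (∃; _×_; _,_)
open import Data.Rational.Base as ℚ using (ℚ; 0ℚ; 1ℚ; ½; ∣_∣; mkℚ)
import Data.Rational.Properties as ℚₚ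
import Data.Rational.Unnormalised.Base as ℚᵘ
import Data.Rational.Unnormalised.Properties as ℚᵘₚ
open import Data.Rational.Solver using (module +-*-Solver)
open import Data.Sum.Base using (_⊎_; [_,_]′; swap)
open import Data.Vec.Base as Vec using (Vec; []; _∷_; lookup)
open import Data.Vec.Functional using (Vector)
open import Function.Bundles using (_⇔_)
open import Level using (0ℓ)
open import Relation.Binary.Core using (Rel)
open import Relation.Binary.Definitions using (Symmetric; Irreflexive)
open import Relation.Binary.PropositionalEquality
  using (_≡_; _≢_; refl; sym; trans; cong; subst; subst₂)
open import Relation.Binary.Structures using (IsEquivalence)
open import Relation.Nullary using (¬_; does)
open import Relation.Nullary.Decidable using (from-yes; ¬?)

-- Real numbers are Cauchy sequences of rationals, compared up to null
-- sequences.  "Nonzero" is the negation x ≉ 0ℝ rather than apartness.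

IsCauchy : (ℕ → ℚ) → Set
IsCauchy x = ∀ ε → 0ℚ ℚ.< ε →
  ∃ λ N → ∀ m n → N ℕ.≤ m → N ℕ.≤ n → ∣ x m ℚ.- x n ∣ ℚ.≤ ε

record ℝ : Set where
  constructor mkℝ
  field
    seq    : ℕ → ℚ
    cauchy : IsCauchy seq

open ℝ public

infix 4 _≈_ _≉_ _<_

record _≈_ (x y : ℝ) : Set where
  constructor mk≈
  field
    close : ∀ ε → 0ℚ ℚ.< ε →
      ∃ λ N → ∀ n → N ℕ.≤ n → ∣ seq x n ℚ.- seq y n ∣ ℚ.≤ ε

open _≈_ public

_≉_ : Rel ℝ 0ℓ
x ≉ y = ¬ (x ≈ y)

record _<_ (x y : ℝ) : Set where
  constructor mk<
  field
    gap       : ℚ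
    gap>0     : 0ℚ ℚ.< gap
    start     : ℕ
    separated : ∀ n → start ℕ.≤ n → seq x n ℚ.+ gap ℚ.≤ seq y n

private module R = +-*-Solver
open R using (_:=_; _:+_; _:*_; _:-_; :-_; con)

module Estimates where
  dist[_,_]≤_ : ℚ → ℚ → ℚ → Set
  dist[ p , q ]≤ ε = ∣ p ℚ.- q ∣ ℚ.≤ ε

  halve : ∀ {ε} → 0ℚ ℚ.< ε → 0ℚ ℚ.< ½ ℚ.* ε
  halve {ε} 0<ε = subst (ℚ._< ½ ℚ.* ε) (ℚₚ.*-zeroʳ ½) (ℚₚ.*-monoʳ-<-pos ½ 0<ε)

  halves : ∀ ε → ½ ℚ.* ε ℚ.+ ½ ℚ.* ε ≡ ε
  halves = R.solve 1 (λ e → con ½ :* e :+ con ½ :* e := e) refl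

  ≤-respʳ : ∀ {p q r} → q ≡ r → p ℚ.≤ q → p ℚ.≤ r
  ≤-respʳ refl p≤q = p≤q

  dist-refl : ∀ p {ε} → 0ℚ ℚ.< ε → dist[ p , p ]≤ ε
  dist-refl p {ε} 0<ε =
    subst (λ d → ∣ d ∣ ℚ.≤ ε) (sym (ℚₚ.+-inverseʳ p)) (ℚₚ.<⇒≤ 0<ε)

  dist-sym : ∀ p q {ε} → dist[ p , q ]≤ ε → dist[ q , p ]≤ ε
  dist-sym p q {ε} = subst (ℚ._≤ ε) (trans (sym (ℚₚ.∣-p∣≡∣p∣ (p ℚ.- q)))
    (cong ∣_∣ (R.solve 2 (λ a b → :- (a :- b) := b :- a) refl p q)))

  ∣∣-+ : ∀ p q {δ η} → ∣ p ∣ ℚ.≤ δ → ∣ q ∣ ℚ.≤ η → ∣ p ℚ.+ q ∣ ℚ.≤ δ ℚ.+ η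
  ∣∣-+ p q h k = ℚₚ.≤-trans (ℚₚ.∣p+q∣≤∣p∣+∣q∣ p q) (ℚₚ.+-mono-≤ h k)

  ∣∣-* : ∀ p q {K δ} → ∣ p ∣ ℚ.≤ K → ∣ q ∣ ℚ.≤ δ → ∣ p ℚ.* q ∣ ℚ.≤ K ℚ.* δ
  ∣∣-* p q {K} {δ} h k = subst (ℚ._≤ K ℚ.* δ) (sym (ℚₚ.∣p*q∣≡∣p∣*∣q∣ p q))
    (ℚₚ.≤-trans
      (ℚₚ.*-monoʳ-≤-nonNeg ∣ q ∣ {{ℚₚ.∣-∣-nonNeg q}} h)
      (ℚₚ.*-monoˡ-≤-nonNeg K {{ℚ.nonNegative (ℚₚ.≤-trans (ℚₚ.0≤∣p∣ p) h)}} k))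

  dist-trans : ∀ p q r {δ η} → dist[ p , q ]≤ δ → dist[ q , r ]≤ η → dist[ p , r ]≤ (δ ℚ.+ η)
  dist-trans p q r {δ} {η} h k = subst (λ d → ∣ d ∣ ℚ.≤ δ ℚ.+ η)
    (R.solve 3 (λ a b c → (a :- b) :+ (b :- c) := a :- c) refl p q r)
    (∣∣-+ (p ℚ.- q) (q ℚ.- r) h k)

  dist-neg : ∀ p q {ε} → dist[ p , q ]≤ ε → dist[ ℚ.- p , ℚ.- q ]≤ ε
  dist-neg p q {ε} h = subst (λ d → ∣ d ∣ ℚ.≤ ε)
    (R.solve 2 (λ a b → b :- a := (:- a) :- (:- b)) refl p q) (dist-sym p q h)

  dist-+ : ∀ p q p′ q′ {δ η} → dist[ p , p′ ]≤ δ → dist[ q , q′ ]≤ η →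
           dist[ (p ℚ.+ q) , (p′ ℚ.+ q′) ]≤ (δ ℚ.+ η)
  dist-+ p q p′ q′ {δ} {η} h k = subst (λ d → ∣ d ∣ ℚ.≤ δ ℚ.+ η)
    (R.solve 4 (λ a b c d → (a :- c) :+ (b :- d) := (a :+ b) :- (c :+ d)) refl p q p′ q′)
    (∣∣-+ (p ℚ.- p′) (q ℚ.- q′) h k)

  dist-* : ∀ p q p′ q′ {K L δ} → ∣ p ∣ ℚ.≤ K → ∣ q′ ∣ ℚ.≤ L →
           dist[ p , p′ ]≤ δ → dist[ q , q′ ]≤ δ →
           dist[ (p ℚ.* q) , (p′ ℚ.* q′) ]≤ ((K ℚ.+ L) ℚ.* δ)
  dist-* p q p′ q′ {K} {L} {δ} hp hq h k = subst₂ (λ d e → ∣ d ∣ ℚ.≤ e)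
    (R.solve 4 (λ a b c d → a :* (b :- d) :+ d :* (a :- c) := a :* b :- c :* d) refl p q p′ q′)
    (sym (ℚₚ.*-distribʳ-+ δ K L))
    (∣∣-+ (p ℚ.* (q ℚ.- q′)) (q′ ℚ.* (p ℚ.- p′))
      (∣∣-* p (q ℚ.- q′) hp k) (∣∣-* q′ (p ℚ.- p′) hq h))

  quotient : ∀ K ε → 0ℚ ℚ.< K → 0ℚ ℚ.< ε → ∃ λ δ → 0ℚ ℚ.< δ × K ℚ.* δ ≡ ε
  quotient K ε 0<K 0<ε = K⁻¹ ℚ.* ε , 0<δ , Kδ≡ε
    where
    instance
      posK = ℚ.positive 0<K
      nzK = ℚₚ.pos⇒nonZero K
    K⁻¹ = ℚ.1/ K
    0<δ : 0ℚ ℚ.< K⁻¹ ℚ.* ε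
    0<δ = subst (ℚ._< K⁻¹ ℚ.* ε) (ℚₚ.*-zeroʳ K⁻¹)
      (ℚₚ.*-monoʳ-<-pos K⁻¹ {{ℚₚ.1/pos⇒pos K}} 0<ε)
    Kδ≡ε : K ℚ.* (K⁻¹ ℚ.* ε) ≡ ε
    Kδ≡ε = trans (sym (ℚₚ.*-assoc K K⁻¹ ε))
      (trans (cong (ℚ._* ε) (ℚₚ.*-inverseʳ K)) (ℚₚ.*-identityˡ ε))

  bound : ∀ x → IsCauchy x →
    ∃ λ K → 0ℚ ℚ.< K × ∃ λ N → ∀ n → N ℕ.≤ n → ∣ x n ∣ ℚ.≤ K
  bound x cx with cx 1ℚ (ℚₚ.positive⁻¹ 1ℚ)
  ... | N , h = 1ℚ ℚ.+ ∣ x N ∣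
      , ℚₚ.+-mono-<-≤ (ℚₚ.positive⁻¹ 1ℚ) (ℚₚ.0≤∣p∣ (x N)) , N , λ n N≤n →
        subst (λ d → ∣ d ∣ ℚ.≤ 1ℚ ℚ.+ ∣ x N ∣)
          (R.solve 2 (λ a b → (a :- b) :+ b := a) refl (x n) (x N))
          (∣∣-+ (x n ℚ.- x N) (x N) (h n N N≤n ℕₚ.≤-refl) ℚₚ.≤-refl)

  ≤ˡ : ∀ {m n k} → m ℕ.⊔ n ℕ.≤ k → m ℕ.≤ k
  ≤ˡ {m} {n} = ℕₚ.≤-trans (ℕₚ.m≤m⊔n m n)

  ≤ʳ : ∀ {m n k} → m ℕ.⊔ n ℕ.≤ k → n ℕ.≤ k
  ≤ʳ {m} {n} = ℕₚ.≤-trans (ℕₚ.m≤n⊔m m n)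

  abstract
    cauchy-const : ∀ q → IsCauchy (λ _ → q)
    cauchy-const q ε 0<ε = 0 , λ _ _ _ _ → dist-refl q 0<ε

    cauchy-+ : ∀ {x y} → IsCauchy x → IsCauchy y → IsCauchy (λ n → x n ℚ.+ y n)
    cauchy-+ {x} {y} cx cy ε 0<ε
      with cx (½ ℚ.* ε) (halve 0<ε) | cy (½ ℚ.* ε) (halve 0<ε)
    ... | M , h | N , k = M ℕ.⊔ N , λ m n p q → ≤-respʳ (halves ε)
      (dist-+ (x m) (y m) (x n) (y n)
        (h m n (≤ˡ p) (≤ˡ q)) (k m n (≤ʳ {M} p) (≤ʳ {M} q)))

    cauchy-neg : ∀ {x} → IsCauchy x → IsCauchy (λ n → ℚ.- x n)
    cauchy-neg {x} cx ε 0<ε with cx ε 0<ε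
    ... | N , h = N , λ m n p q → dist-neg (x m) (x n) (h m n p q)

    cauchy-* : ∀ {x y} → IsCauchy x → IsCauchy y → IsCauchy (λ n → x n ℚ.* y n)
    cauchy-* {x} {y} cx cy ε 0<ε =
      let K , 0<K , A , hK = bound x cx
          L , 0<L , B , hL = bound y cy
          δ , 0<δ , eq     = quotient (K ℚ.+ L) ε (ℚₚ.+-mono-< 0<K 0<L) 0<ε
          M , h = cx δ 0<δ
          N , k = cy δ 0<δ
      in (A ℕ.⊔ B) ℕ.⊔ (M ℕ.⊔ N) , λ m n p q → ≤-respʳ eq
           (dist-* (x m) (y m) (x n) (y n)
             (hK m (≤ˡ (≤ˡ p))) (hL n (≤ʳ {A} (≤ˡ q)))
             (h m n (≤ˡ (≤ʳ {A ℕ.⊔ B} p)) (≤ˡ (≤ʳ {A ℕ.⊔ B} q)))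
             (k m n (≤ʳ {M} (≤ʳ {A ℕ.⊔ B} p)) (≤ʳ {M} (≤ʳ {A ℕ.⊔ B} q))))

open Estimates

infixl 7 _*_
infixl 6 _+_ _-_
infix  8 -_

fromℚ : ℚ → ℝ
fromℚ q = mkℝ (λ _ → q) (cauchy-const q)

_+_ _*_ : ℝ → ℝ → ℝ
x + y = mkℝ (λ n → seq x n ℚ.+ seq y n) (cauchy-+ {seq x} {seq y} (cauchy x) (cauchy y))
x * y = mkℝ (λ n → seq x n ℚ.* seq y n) (cauchy-* {seq x} {seq y} (cauchy x) (cauchy y))

-_ : ℝ → ℝ
- x = mkℝ (λ n → ℚ.- seq x n) (cauchy-neg {seq x} (cauchy x))

_-_ : ℝ → ℝ → ℝ
x - y = x + (- y)

0ℝ 1ℝ 2ℝ 3ℝ 4ℝ -1ℝ -2ℝ -4ℝ : ℝ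
0ℝ  = fromℚ 0ℚ
1ℝ  = fromℚ 1ℚ
2ℝ  = 1ℝ + 1ℝ
3ℝ  = 2ℝ + 1ℝ
4ℝ  = 3ℝ + 1ℝ
-1ℝ = - 1ℝ
-2ℝ = - 2ℝ
-4ℝ = - 4ℝ

module RingLaws where
  abstract
    pointwise : ∀ {x y} → (∀ n → seq x n ≡ seq y n) → x ≈ y
    pointwise {x} {y} eq = mk≈ λ ε 0<ε → 0 , λ n _ →
      subst (λ q → dist[ seq x n , q ]≤ ε) (eq n) (dist-refl (seq x n) 0<ε)

    ≈-isEquivalence : IsEquivalence _≈_
    ≈-isEquivalence = record
      { refl  = pointwise λ _ → refl
      ; sym   = λ {x} {y} x≈y → mk≈ λ ε 0<ε → let N , h = close x≈y ε 0<ε in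
                  N , λ n p → dist-sym (seq x n) (seq y n) (h n p)
      ; trans = λ {x} {y} {z} x≈y y≈z → mk≈ λ ε 0<ε →
          let M , h = close x≈y (½ ℚ.* ε) (halve 0<ε)
              N , k = close y≈z (½ ℚ.* ε) (halve 0<ε)
          in M ℕ.⊔ N , λ n p → ≤-respʳ (halves ε)
               (dist-trans (seq x n) (seq y n) (seq z n) (h n (≤ˡ p)) (k n (≤ʳ {M} p)))
      }

    +-cong : ∀ {x x′ y y′} → x ≈ x′ → y ≈ y′ → x + y ≈ x′ + y′
    +-cong {x} {x′} {y} {y′} x≈ y≈ = mk≈ λ ε 0<ε →
      let M , h = close x≈ (½ ℚ.* ε) (halve 0<ε)
          N , k = close y≈ (½ ℚ.* ε) (halve 0<ε)
      in M ℕ.⊔ N , λ n p → ≤-respʳ (halves ε)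
           (dist-+ (seq x n) (seq y n) (seq x′ n) (seq y′ n) (h n (≤ˡ p)) (k n (≤ʳ {M} p)))

    neg-cong : ∀ {x y} → x ≈ y → - x ≈ - y
    neg-cong {x} {y} x≈y = mk≈ λ ε 0<ε → let N , h = close x≈y ε 0<ε in
      N , λ n p → dist-neg (seq x n) (seq y n) (h n p)

    *-cong : ∀ {x x′ y y′} → x ≈ x′ → y ≈ y′ → x * y ≈ x′ * y′
    *-cong {x} {x′} {y} {y′} x≈ y≈ = mk≈ λ ε 0<ε →
      let K , 0<K , A , hK  = bound (seq x) (cauchy x)
          L , 0<L , B , hL  = bound (seq y′) (cauchy y′)
          δ , 0<δ , eq      = quotient (K ℚ.+ L) ε (ℚₚ.+-mono-< 0<K 0<L) 0<ε
          M , h = close x≈ δ 0<δ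
          N , k = close y≈ δ 0<δ
      in (A ℕ.⊔ B) ℕ.⊔ (M ℕ.⊔ N) , λ n p → ≤-respʳ eq
           (dist-* (seq x n) (seq y n) (seq x′ n) (seq y′ n)
             (hK n (≤ˡ (≤ˡ p))) (hL n (≤ʳ {A} (≤ˡ p)))
             (h n (≤ˡ (≤ʳ {A ℕ.⊔ B} p))) (k n (≤ʳ {M} (≤ʳ {A ℕ.⊔ B} p))))

    +-*-isCommutativeRing : IsCommutativeRing _≈_ _+_ _*_ -_ 0ℝ 1ℝ
    +-*-isCommutativeRing = record
      { isRing = record
        { +-isAbelianGroup = record
          { isGroup = record
            { isMonoid = record
              { isSemigroup = record
                { isMagma = record { isEquivalence = ≈-isEquivalence ; ∙-cong = +-cong }
                ; assoc = λ x y z → pointwise λ n → ℚₚ.+-assoc (seq x n) (seq y n) (seq z n)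
                }
              ; identity = (λ x → pointwise λ n → ℚₚ.+-identityˡ (seq x n))
                         , (λ x → pointwise λ n → ℚₚ.+-identityʳ (seq x n))
              }
            ; inverse = (λ x → pointwise λ n → ℚₚ.+-inverseˡ (seq x n))
                      , (λ x → pointwise λ n → ℚₚ.+-inverseʳ (seq x n))
            ; ⁻¹-cong = neg-cong
            }
          ; comm = λ x y → pointwise λ n → ℚₚ.+-comm (seq x n) (seq y n)
          }
        ; *-cong = *-cong
        ; *-assoc = λ x y z → pointwise λ n → ℚₚ.*-assoc (seq x n) (seq y n) (seq z n)
        ; *-identity = (λ x → pointwise λ n → ℚₚ.*-identityˡ (seq x n))
                     , (λ x → pointwise λ n → ℚₚ.*-identityʳ (seq x n))
        ; distrib = (λ x y z → pointwise λ n → ℚₚ.*-distribˡ-+ (seq x n) (seq y n) (seq z n))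
                  , (λ x y z → pointwise λ n → ℚₚ.*-distribʳ-+ (seq x n) (seq y n) (seq z n))
        }
      ; *-comm = λ x y → pointwise λ n → ℚₚ.*-comm (seq x n) (seq y n)
      }

open RingLaws

ℝ-commutativeRing : CommutativeRing 0ℓ 0ℓ
ℝ-commutativeRing = record { isCommutativeRing = +-*-isCommutativeRing }

open CommutativeRing ℝ-commutativeRing public using (setoid; +-rawMonoid)

open import Data.List.Relation.Binary.Permutation.Setoid setoid using (_↭_)

-- √2, as the limit of xₙ₊₁ = xₙ + (2 − xₙ²)/4 from x₀ = 1

module Sqrt2Defect where
  2ℚ ¼ 3/2 : ℚ
  2ℚ = + 2 ℚ./ 1
  ¼ = + 1 ℚ./ 4
  3/2 = + 3 ℚ./ 2

  defect : ℚ → ℚ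
  defect x = 2ℚ ℚ.- x ℚ.* x

open Sqrt2Defect

√2-seq : ℕ → ℚ
√2-seq zero    = 1ℚ
√2-seq (suc n) = √2-seq n ℚ.+ ¼ ℚ.* defect (√2-seq n)

module Sqrt2Estimates where
  ½^ : ℕ → ℚ
  ½^ zero    = 1ℚ
  ½^ (suc n) = ½ ℚ.* ½^ n

  ≤-by : ∀ {p q} d → 0ℚ ℚ.≤ d → p ℚ.+ d ≡ q → p ℚ.≤ q
  ≤-by {p} d 0≤d eq = subst₂ ℚ._≤_ (ℚₚ.+-identityʳ p) eq (ℚₚ.+-monoʳ-≤ p 0≤d)

  0≤* : ∀ {p q} → 0ℚ ℚ.≤ p → 0ℚ ℚ.≤ q → 0ℚ ℚ.≤ p ℚ.* q
  0≤* {p} {q} 0≤p 0≤q = subst (ℚ._≤ p ℚ.* q) (ℚₚ.*-zeroʳ p)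
    (ℚₚ.*-monoˡ-≤-nonNeg p {{ℚ.nonNegative 0≤p}} 0≤q)

  0≤+ : ∀ {p q} → 0ℚ ℚ.≤ p → 0ℚ ℚ.≤ q → 0ℚ ℚ.≤ p ℚ.+ q
  0≤+ = ℚₚ.+-mono-≤

  0≤- : ∀ {p q} → p ℚ.≤ q → 0ℚ ℚ.≤ q ℚ.- p
  0≤- {p} {q} p≤q = subst (ℚ._≤ q ℚ.- p) (ℚₚ.+-inverseʳ p) (ℚₚ.+-monoˡ-≤ (ℚ.- p) p≤q)

  0≤[_] : ∀ q {{_ : ℚ.NonNegative q}} → 0ℚ ℚ.≤ q
  0≤[ q ] = ℚₚ.nonNegative⁻¹ q

  record Approx (x η : ℚ) : Set where
    field
      1≤x  : 1ℚ ℚ.≤ x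
      x≤   : x ℚ.≤ 3/2
      0≤d  : 0ℚ ℚ.≤ defect x
      d≤   : defect x ℚ.≤ η

  abstract
    approx : ∀ n → Approx (√2-seq n) (½^ n)
    approx zero = record
      { 1≤x = ℚₚ.≤-refl ; x≤ = from-yes (1ℚ ℚₚ.≤? 3/2)
      ; 0≤d = from-yes (0ℚ ℚₚ.≤? 1ℚ) ; d≤ = ℚₚ.≤-refl }
    approx (suc n) = record
      { 1≤x = ≤-by _ (0≤+ (0≤- 1≤x) (0≤* 0≤[ ¼ ] 0≤d))
          (R.solve 2 (λ a e → con 1ℚ :+ ((a :- con 1ℚ) :+ con ¼ :* e) := a :+ con ¼ :* e) refl x d)
      ; x≤  = ≤-by ((¼ ℚ.* (2ℚ ℚ.- x)) ℚ.* (2ℚ ℚ.- x)) (0≤* (0≤* 0≤[ ¼ ] 0≤2-x) 0≤2-x)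
          (R.solve 1 (λ a → a :+ con ¼ :* (con 2ℚ :- a :* a)
                              :+ (con ¼ :* (con 2ℚ :- a)) :* (con 2ℚ :- a) := con 3/2) refl x)
      ; 0≤d = subst (0ℚ ℚ.≤_)
          (R.solve 1 (λ a → (con 2ℚ :- a :* a)
              :* (con (½ ℚ.* ¼) :+ con ½ :* (con 3/2 :- a)
                  :+ con (¼ ℚ.* ¼) :* ((a :- con 1ℚ) :* (a :+ con 1ℚ)) :+ con (¼ ℚ.* ¼))
            := con 2ℚ :- (a :+ con ¼ :* (con 2ℚ :- a :* a)) :* (a :+ con ¼ :* (con 2ℚ :- a :* a)))
            refl x)
          (0≤* 0≤d (0≤+ (0≤+ (0≤+ 0≤[ ½ ℚ.* ¼ ] (0≤* 0≤[ ½ ] (0≤- x≤)))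
            (0≤* 0≤[ ¼ ℚ.* ¼ ] (0≤* (0≤- 1≤x) 0≤x+1))) 0≤[ ¼ ℚ.* ¼ ]))
      ; d≤  = ℚₚ.≤-trans
          (≤-by (d ℚ.* (½ ℚ.* (x ℚ.- 1ℚ) ℚ.+ (¼ ℚ.* ¼) ℚ.* d))
            (0≤* 0≤d (0≤+ (0≤* 0≤[ ½ ] (0≤- 1≤x)) (0≤* 0≤[ ¼ ℚ.* ¼ ] 0≤d)))
            (R.solve 1 (λ a → con 2ℚ :- (a :+ con ¼ :* (con 2ℚ :- a :* a)) :* (a :+ con ¼ :* (con 2ℚ :- a :* a))
                :+ (con 2ℚ :- a :* a) :* (con ½ :* (a :- con 1ℚ) :+ con (¼ ℚ.* ¼) :* (con 2ℚ :- a :* a))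
              := con ½ :* (con 2ℚ :- a :* a)) refl x))
          (ℚₚ.*-monoˡ-≤-nonNeg ½ d≤)
      }
      where
      open Approx (approx n)
      x d : ℚ
      x = √2-seq n
      d = defect x
      0≤2-x : 0ℚ ℚ.≤ 2ℚ ℚ.- x
      0≤2-x = 0≤- (ℚₚ.≤-trans x≤ (from-yes (3/2 ℚₚ.≤? 2ℚ)))
      0≤x+1 : 0ℚ ℚ.≤ x ℚ.+ 1ℚ
      0≤x+1 = 0≤+ (ℚₚ.≤-trans 0≤[ 1ℚ ] 1≤x) 0≤[ 1ℚ ]

    0≤½^ : ∀ n → 0ℚ ℚ.≤ ½^ n
    0≤½^ n = ℚₚ.≤-trans (Approx.0≤d (approx n)) (Approx.d≤ (approx n))

    ½^-anti : ∀ {m n} → m ℕ.≤ n → ½^ n ℚ.≤ ½^ m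
    ½^-anti {n = n} m≤n = go (ℕₚ.≤⇒≤′ m≤n)
      where
      go : ∀ {m n} → m ℕ.≤′ n → ½^ n ℚ.≤ ½^ m
      go (ℕ.≤′-reflexive refl) = ℚₚ.≤-refl
      go (ℕ.≤′-step {n} p) = ℚₚ.≤-trans
        (≤-by (½ ℚ.* ½^ n) (0≤* 0≤[ ½ ] (0≤½^ n)) (halves (½^ n))) (go p)

    ι : ℕ → ℚ
    ι zero    = 0ℚ
    ι (suc n) = 1ℚ ℚ.+ ι n

    0≤ι : ∀ n → 0ℚ ℚ.≤ ι n
    0≤ι zero    = ℚₚ.≤-refl
    0≤ι (suc n) = 0≤+ 0≤[ 1ℚ ] (0≤ι n)

    ι½^≤1 : ∀ n → ι (suc n) ℚ.* ½^ n ℚ.≤ 1ℚ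
    ι½^≤1 zero = ℚₚ.≤-refl
    ι½^≤1 (suc n) = ℚₚ.≤-trans
      (≤-by ((½ ℚ.* ι n) ℚ.* ½^ n) (0≤* (0≤* 0≤[ ½ ] (0≤ι n)) (0≤½^ n))
        (R.solve 2 (λ a h → (con 1ℚ :+ (con 1ℚ :+ a)) :* (con ½ :* h) :+ (con ½ :* a) :* h
                        := (con 1ℚ :+ a) :* h) refl (ι n) (½^ n)))
      (ι½^≤1 n)

    toℚᵘ-ι : ∀ n → ℚ.toℚᵘ (ι n) ℚᵘ.≃ ℚᵘ.mkℚᵘ (+ n) 0
    toℚᵘ-ι zero    = ℚᵘₚ.≃-refl
    toℚᵘ-ι (suc n) = ℚᵘₚ.≃-trans (ℚₚ.toℚᵘ-homo-+ 1ℚ (ι n))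
      (ℚᵘₚ.≃-trans (ℚᵘₚ.+-congʳ ℚᵘ.1ℚᵘ (toℚᵘ-ι n))
        (ℚᵘ.*≡* (cong (λ z → (ℤ.1ℤ ℤ.+ z) ℤ.* ℤ.1ℤ) (ℤₚ.*-identityʳ (+ n)))))

    archimedean : ∀ ε → 0ℚ ℚ.< ε → ∃ λ n → ½^ n ℚ.≤ ε
    archimedean ε@(mkℚ (ℤ.+[1+ p ]) d _) 0<ε = d , ℚₚ.*-cancelˡ-≤-pos (ι (suc d))
      {{ℚ.positive (ℚₚ.+-mono-<-≤ (ℚₚ.positive⁻¹ 1ℚ) (0≤ι d))}}
      (ℚₚ.≤-trans (ι½^≤1 d) 1≤ιε)
      where
      1≤ιε : 1ℚ ℚ.≤ ι (suc d) ℚ.* ε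
      1≤ιε = ℚₚ.toℚᵘ-cancel-≤ (ℚᵘₚ.≤-respʳ-≃
        (ℚᵘₚ.≃-sym (ℚᵘₚ.≃-trans (ℚₚ.toℚᵘ-homo-* (ι (suc d)) ε)
          (ℚᵘₚ.*-congʳ {ℚ.toℚᵘ ε} (toℚᵘ-ι (suc d)))))
        (ℚᵘ.*≤* (ℤ.+≤+ (subst₂ ℕ._≤_
          (sym (trans (ℕₚ.*-identityˡ _) (ℕₚ.*-identityˡ (suc d))))
          (sym (ℕₚ.*-identityʳ _))
          (ℕₚ.m≤m*n (suc d) (suc p))))))
    archimedean (mkℚ (+ 0) d _) (ℚ.*<* (ℤ.+<+ ()))
    archimedean (mkℚ (ℤ.-[1+_] _) d _) (ℚ.*<* ())

    √2-cauchy : IsCauchy √2-seq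
    √2-cauchy ε 0<ε with archimedean ε 0<ε
    ... | N , ½ᴺ≤ε = N , λ m n N≤m N≤n → ℚₚ.≤-trans (lemma m n N≤m N≤n) ½ᴺ≤ε
      where
      side : ∀ m n → N ℕ.≤ m → defect (√2-seq m) ℚ.- defect (√2-seq n) ℚ.≤ ½^ N
      side m n N≤m = ℚₚ.≤-trans
        (≤-by (defect (√2-seq n)) (Approx.0≤d (approx n))
          (R.solve 2 (λ a b → (a :- b) :+ b := a) refl (defect (√2-seq m)) (defect (√2-seq n))))
        (ℚₚ.≤-trans (Approx.d≤ (approx m)) (½^-anti N≤m))

      defects : ∀ m n → N ℕ.≤ m → N ℕ.≤ n →
                ∣ defect (√2-seq m) ℚ.- defect (√2-seq n) ∣ ℚ.≤ ½^ N
      defects m n N≤m N≤n =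
        [ (λ e → subst (ℚ._≤ ½^ N) (sym e) (side m n N≤m))
        , (λ e → subst (ℚ._≤ ½^ N)
            (sym (trans e (R.solve 2 (λ a b → :- (a :- b) := b :- a) refl
              (defect (√2-seq m)) (defect (√2-seq n)))))
            (side n m N≤n))
        ]′ (ℚₚ.∣p∣≡p∨∣p∣≡-p (defect (√2-seq m) ℚ.- defect (√2-seq n)))

      lemma : ∀ m n → N ℕ.≤ m → N ℕ.≤ n → dist[ √2-seq m , √2-seq n ]≤ (½^ N)
      lemma m n N≤m N≤n = ℚₚ.≤-trans (subst₂ ℚ._≤_ (ℚₚ.*-identityˡ _) eq
          (ℚₚ.*-monoʳ-≤-nonNeg ∣ x ℚ.- y ∣ {{ℚₚ.∣-∣-nonNeg (x ℚ.- y)}} 1≤x+y))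
        (defects n m N≤n N≤m)
        where
        x y : ℚ
        x = √2-seq m
        y = √2-seq n
        0≤y : 0ℚ ℚ.≤ y
        0≤y = ℚₚ.≤-trans 0≤[ 1ℚ ] (Approx.1≤x (approx n))
        1≤x+y : 1ℚ ℚ.≤ x ℚ.+ y
        1≤x+y = ℚₚ.≤-trans (Approx.1≤x (approx m)) (≤-by y 0≤y refl)
        eq : (x ℚ.+ y) ℚ.* ∣ x ℚ.- y ∣ ≡ ∣ defect y ℚ.- defect x ∣
        eq = trans
          (cong (ℚ._* ∣ x ℚ.- y ∣) (sym (ℚₚ.0≤p⇒∣p∣≡p (ℚₚ.≤-trans 0≤[ 1ℚ ] 1≤x+y))))
          (trans (sym (ℚₚ.∣p*q∣≡∣p∣*∣q∣ (x ℚ.+ y) (x ℚ.- y)))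
            (cong ∣_∣ (R.solve 2 (λ a b → (a :+ b) :* (a :- b)
              := (con 2ℚ :- b :* b) :- (con 2ℚ :- a :* a)) refl x y)))

open Sqrt2Estimates

√2 : ℝ
√2 = mkℝ √2-seq √2-cauchy

abstract
  √2*√2≈2 : √2 * √2 ≈ 2ℝ
  √2*√2≈2 = mk≈ λ ε 0<ε → let N , ½ᴺ≤ε = archimedean ε 0<ε in
    N , λ n N≤n → dist-sym 2ℚ (√2-seq n ℚ.* √2-seq n)
      (subst (ℚ._≤ ε) (sym (ℚₚ.0≤p⇒∣p∣≡p (Approx.0≤d (approx n))))
        (ℚₚ.≤-trans (Approx.d≤ (approx n)) (ℚₚ.≤-trans (½^-anti N≤n) ½ᴺ≤ε)))

  0<√2 : 0ℝ < √2
  0<√2 = mk< 1ℚ (ℚₚ.positive⁻¹ 1ℚ) 0 λ n _ → Approx.1≤x (approx n)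

open RawMonoidDefinitions +-rawMonoid using (sum)

Matrix : ℕ → Set
Matrix n = Fin n → Fin n → ℝ

infix  4 _≋_ _≋ᴹ_
infixl 7 _·_ _⊙_ _∙ᵛ_

_≋_ : ∀ {n} → Rel (Vector ℝ n) 0ℓ
u ≋ v = ∀ i → u i ≈ v i

_≋ᴹ_ : ∀ {n} → Rel (Matrix n) 0ℓ
A ≋ᴹ B = ∀ i j → A i j ≈ B i j

0ᵛ : ∀ {n} → Vector ℝ n
0ᵛ _ = 0ℝ

O I : ∀ {n} → Matrix n
O _ _ = 0ℝ
I i j = if does (i ≟ j) then 1ℝ else 0ℝ

_·_ _⊙_ ⟦_,_⟧ : ∀ {n} → Matrix n → Matrix n → Matrix n
(A · B) i j = sum λ k → A i k * B k j
(A ⊙ B) i j = A i j * B i j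
⟦ A , X ⟧ i j = (A · X) i j - (X · A) i j

_∙ᵛ_ : ∀ {n} → Matrix n → Vector ℝ n → Vector ℝ n
(A ∙ᵛ v) i = sum λ k → A i k * v k

infixr 8 _^_

_^_ : ∀ {n} → Matrix n → ℕ → Matrix n
A ^ zero  = I
A ^ suc k = A · (A ^ k)

tr : ∀ {n} → Matrix n → ℝ
tr A = sum λ i → A i i

IsSymmetric : ∀ {n} → Matrix n → Set
IsSymmetric A = ∀ i j → A i j ≈ A j i

linComb : ∀ {n d} → Vector ℝ d → (Fin d → Vector ℝ n) → Vector ℝ n
linComb c b i = sum λ k → c k * b k i

LinearlyIndependent : ∀ {n d} → (Fin d → Vector ℝ n) → Set
LinearlyIndependent b = ∀ c → linComb c b ≋ 0ᵛ → ∀ k → c k ≈ 0ℝ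

record IsBasisOf {n d} (P : Vector ℝ n → Set) (b : Fin d → Vector ℝ n) : Set where
  field
    inside      : ∀ k → P (b k)
    independent : LinearlyIndependent b
    spanning    : ∀ v → P v → ∃ λ c → v ≋ linComb c b

HasDimension : ∀ {n} → (Vector ℝ n → Set) → ℕ → Set
HasDimension {n} P d = ∃ λ (b : Fin d → Vector ℝ n) → IsBasisOf P b

Eigenspace : ∀ {n} → Matrix n → ℝ → Vector ℝ n → Set
Eigenspace A μ v = A ∙ᵛ v ≋ λ i → μ * v i

IsEigenvalue : ∀ {n} → Matrix n → ℝ → Set
IsEigenvalue A μ = ∃ λ v → ¬ (v ≋ 0ᵛ) × Eigenspace A μ v

-- For symmetric matrices, the only ones considered, geometric and
-- algebraic multiplicities agree; multiplicity here is geometric.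
record DistinctEigenvalues {n q} (A : Matrix n) (λs : Vec ℝ q) (ms : Vec ℕ q) : Set where
  field
    increasing   : ∀ {i j} → i <ᶠ j → lookup λs i < lookup λs j
    eigenvalue   : ∀ i → IsEigenvalue A (lookup λs i)
    exhaustive   : ∀ μ → IsEigenvalue A μ → ∃ λ i → μ ≈ lookup λs i
    multiplicity : ∀ i → HasDimension (Eigenspace A (lookup λs i)) (lookup ms i)

HasMultiplicityList : ∀ {n q} → Matrix n → Vec ℕ q → Set
HasMultiplicityList {q = q} A ms = ∃ λ (λs : Vec ℝ q) → DistinctEigenvalues A λs ms

-- The spectrum is a multiset: a list up to permutation.
HasSpectrum : ∀ {n} → Matrix n → List ℝ → Set
HasSpectrum A σ = ∃ λ q → ∃ λ (λs : Vec ℝ q) → ∃ λ (ms : Vec ℕ q) →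
  DistinctEigenvalues A λs ms ×
  σ ↭ List.concat (Vec.toList (Vec.zipWith List.replicate ms λs))

SSP : ∀ {n} → Matrix n → Set
SSP {n} A = ∀ (X : Matrix n) → IsSymmetric X →
  A ⊙ X ≋ᴹ O → I ⊙ X ≋ᴹ O → ⟦ A , X ⟧ ≋ᴹ O → X ≋ᴹ O

SMP : ∀ {n} → Matrix n → Set
SMP {n} A = ∀ (X : Matrix n) → IsSymmetric X →
  A ⊙ X ≋ᴹ O → I ⊙ X ≋ᴹ O → ⟦ A , X ⟧ ≋ᴹ O →
  (∀ i → 2 ℕ.≤ i → i ℕ.< n → tr ((A ^ i) · X) ≈ 0ℝ) → X ≋ᴹ O

record Graph (n : ℕ) : Set₁ where
  field
    Adj        : Rel (Fin n) 0ℓ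
    adj-sym    : Symmetric Adj
    adj-irrefl : Irreflexive _≡_ Adj

record _∈𝒮_ {n} (A : Matrix n) (G : Graph n) : Set where
  open Graph G
  field
    symmetric : IsSymmetric A
    support   : ∀ i j → i ≢ j → A i j ≉ 0ℝ ⇔ Adj i j

-- Edges use the vertex labels 1, …, 12; label k is the element of
-- Fin 12 whose toℕ is k − 1.
H-edges : List (ℕ × ℕ)
H-edges =
  (1 , 2) ∷ (2 , 3) ∷ (3 , 4) ∷ (4 , 5) ∷ (5 , 6) ∷ (1 , 6) ∷
  (1 , 7) ∷ (4 , 7) ∷ (2 , 8) ∷ (5 , 8) ∷ (3 , 9) ∷ (6 , 9) ∷
  (7 , 10) ∷ (8 , 11) ∷ (9 , 12) ∷
  (10 , 11) ∷ (10 , 12) ∷ (11 , 12) ∷ []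

H : Graph 12
H = record
  { Adj        = Adj
  ; adj-sym    = swap
  ; adj-irrefl = λ { {i} refl → [ loopless i , loopless i ]′ }
  }
  where
  label : Fin 12 → ℕ
  label i = suc (toℕ i)

  Adj : Rel (Fin 12) 0ℓ
  Adj i j = (label i , label j) ∈ H-edges ⊎ (label j , label i) ∈ H-edges

  loopless : ∀ i → ¬ ((label i , label i) ∈ H-edges)
  loopless i e = All.lookup
    (from-yes (all? (λ (a , b) → ¬? (a ℕₚ.≟ b)) H-edges)) e refl

B : Matrix 12
B i j = lookup (lookup rows i) j
  where
  rows : Vec (Vec ℝ 12) 12
  rows =
    ( 1ℝ ∷ -1ℝ ∷  0ℝ ∷  0ℝ ∷  0ℝ ∷ -1ℝ ∷  √2 ∷  0ℝ ∷  0ℝ ∷  0ℝ ∷  0ℝ ∷  0ℝ ∷ []) ∷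
    (-1ℝ ∷  1ℝ ∷ -1ℝ ∷  0ℝ ∷  0ℝ ∷  0ℝ ∷  0ℝ ∷  √2 ∷  0ℝ ∷  0ℝ ∷  0ℝ ∷  0ℝ ∷ []) ∷
    ( 0ℝ ∷ -1ℝ ∷  1ℝ ∷ -1ℝ ∷  0ℝ ∷  0ℝ ∷  0ℝ ∷  0ℝ ∷  √2 ∷  0ℝ ∷  0ℝ ∷  0ℝ ∷ []) ∷
    ( 0ℝ ∷  0ℝ ∷ -1ℝ ∷  1ℝ ∷ -1ℝ ∷  0ℝ ∷  √2 ∷  0ℝ ∷  0ℝ ∷  0ℝ ∷  0ℝ ∷  0ℝ ∷ []) ∷
    ( 0ℝ ∷  0ℝ ∷  0ℝ ∷ -1ℝ ∷  1ℝ ∷ -1ℝ ∷  0ℝ ∷  √2 ∷  0ℝ ∷  0ℝ ∷  0ℝ ∷  0ℝ ∷ []) ∷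
    (-1ℝ ∷  0ℝ ∷  0ℝ ∷  0ℝ ∷ -1ℝ ∷  1ℝ ∷  0ℝ ∷  0ℝ ∷  √2 ∷  0ℝ ∷  0ℝ ∷  0ℝ ∷ []) ∷
    ( √2 ∷  0ℝ ∷  0ℝ ∷  √2 ∷  0ℝ ∷  0ℝ ∷ -2ℝ ∷  0ℝ ∷  0ℝ ∷  2ℝ ∷  0ℝ ∷  0ℝ ∷ []) ∷
    ( 0ℝ ∷  √2 ∷  0ℝ ∷  0ℝ ∷  √2 ∷  0ℝ ∷  0ℝ ∷ -2ℝ ∷  0ℝ ∷  0ℝ ∷  2ℝ ∷  0ℝ ∷ []) ∷
    ( 0ℝ ∷  0ℝ ∷  √2 ∷  0ℝ ∷  0ℝ ∷  √2 ∷  0ℝ ∷  0ℝ ∷ -2ℝ ∷  0ℝ ∷  0ℝ ∷  2ℝ ∷ []) ∷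
    ( 0ℝ ∷  0ℝ ∷  0ℝ ∷  0ℝ ∷  0ℝ ∷  0ℝ ∷  2ℝ ∷  0ℝ ∷  0ℝ ∷  0ℝ ∷  1ℝ ∷  1ℝ ∷ []) ∷
    ( 0ℝ ∷  0ℝ ∷  0ℝ ∷  0ℝ ∷  0ℝ ∷  0ℝ ∷  0ℝ ∷  2ℝ ∷  0ℝ ∷  1ℝ ∷  0ℝ ∷  1ℝ ∷ []) ∷
    ( 0ℝ ∷  0ℝ ∷  0ℝ ∷  0ℝ ∷  0ℝ ∷  0ℝ ∷  0ℝ ∷  0ℝ ∷  2ℝ ∷  1ℝ ∷  1ℝ ∷  0ℝ ∷ []) ∷
    []

{-# OPTIONS --safe #-}

-- The failure of the SSP is a dimension count.  If the columns of U k are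
-- a basis of the k-th eigenspace of A, every Σₖ U k S k (U k)ᵀ with
-- symmetric S k commutes with A; these matrices form a space of dimension
-- 6 + 15 + 10 = 31, while A ∘ X = O and I ∘ X = O are only 18 + 12 = 30
-- linear conditions.  Gaussian elimination over the Cauchy reals is
-- harmless here, as the claim is negative and ≈ is stable under double
-- negation.
--
-- The entries of B lie in ℤ[√2], where equality is decidable, so that
-- fraction-free elimination decides whether linear forms have a common
-- zero other than 0.  This yields both that explicit eigenvectors span the
-- eigenspaces and that B has the SMP, for which the trace condition with
-- i = 2 suffices.  Further eigenvalues are excluded by B³ + B² = 12 B.
module Submission where

import Algebra.Properties.Semiring.Sum as SemiringSum
import Algebra.Solver.Ring as RingSolver
open import Algebra.Bundles using (CommutativeRing)
open import Algebra.Solver.Ring.AlmostCommutativeRing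
  using (fromCommutativeRing; _-Raw-AlmostCommutative⟶_)
open import Data.Bool.Base using (Bool; true; false; if_then_else_; _∧_; _∨_; not)
open import Data.Bool.Properties using (∧-conicalˡ; ∧-conicalʳ)
open import Data.Fin.Base as Fin using (Fin; zero; suc; toℕ; punchIn; punchOut)
open import Data.Fin.Patterns using (0F; 1F; 2F; 6F; 7F; 8F)
import Data.Fin.Properties as Finₚ
open import Data.Fin.Properties
  using (_≟_; all?; any?; <-cmp; punchIn-punchOut; suc-injective)
open import Data.Integer.Base as ℤ using (ℤ; +_)
open import Data.Integer.DivMod using (_/ℕ_)
import Data.Integer.Properties as ℤₚ
open import Data.List.Base as List using (List; []; _∷_)
import Data.List.Membership.DecPropositional as DecMembership
open import Data.List.Membership.Propositional using (_∈_)
open import Data.List.Membership.Propositional.Properties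
  using (∈-filter⁺; ∈-cartesianProduct⁺; ∈-cartesianProductWith⁺; ∈-allFin)
open import Data.List.Relation.Unary.All as All using (All; []; _∷_)
import Data.List.Relation.Unary.All.Properties as Allₚ
open import Data.List.Relation.Unary.Any as Any using (here; there)
import Data.List.Relation.Unary.Any.Properties as Anyₚ
import Data.Maybe.Base as Maybe
open import Data.Nat.Base as ℕ using (ℕ; zero; suc)
open import Data.Nat.DivMod using (_mod_)
import Data.Nat.Properties as ℕₚ
open import Data.Product using (_×_; _,_; ∃; proj₁; proj₂)
import Data.Product.Base as Product
import Data.Product.Properties as Productₚ
open import Data.Rational.Base as ℚ using (ℚ; 0ℚ; 1ℚ; ½; ∣_∣)
open import Data.Rational.Literals using (fromℤ)
import Data.Rational.Properties as ℚₚ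
open import Data.Rational.Solver using (module +-*-Solver)
import Data.Rational.Unnormalised.Base as ℚᵘ
import Data.Rational.Unnormalised.Properties as ℚᵘₚ
open import Data.Sum.Base using (_⊎_; inj₁; inj₂; [_,_]′)
open import Data.Vec.Base as Vec using (Vec; []; _∷_; head; lookup)
open import Data.Vec.Functional using (Vector) renaming (_∷_ to _∷ᶠ_)
open import Data.Vec.Properties
  using (lookup-map; lookup-zipWith; lookup-replicate; lookup∘tabulate)
open import Function.Base using (_∘_)
open import Function.Bundles using (_⇔_; mk⇔; module Equivalence)
open import Relation.Binary.Definitions
  using (DecidableEquality; Tri; tri<; tri≈; tri>)
open import Relation.Binary.PropositionalEquality as ≡ using (_≡_; _≢_)
open import Relation.Nullary using (¬_; Dec; yes; no; does; contradiction)
open import Relation.Nullary.Decidable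
  using (_×-dec_; _⊎-dec_; ¬?; map′; from-yes; dec⇒maybe)
open import Defs
open Estimates using (halve; halves; ≤ˡ; ≤ʳ)
open RingLaws using (pointwise)

open CommutativeRing ℝ-commutativeRing
  using ( semiring; +-cong; +-congˡ; +-congʳ; +-identityˡ; +-identityʳ
        ; *-cong; *-congˡ; *-congʳ; *-identityˡ; *-identityʳ; *-assoc; *-comm
        ; zeroˡ; zeroʳ; distribʳ; -‿cong; -‿inverseʳ)
  renaming (refl to ≈-refl; reflexive to ≈-reflexive; sym to ≈-sym; trans to ≈-trans)
open SemiringSum semiring
  using ( sum; sum-cong-≋; sum-replicate-zero; ∑-distrib-+; ∑-comm
        ; *-distribˡ-sum; *-distribʳ-sum)
open import Data.List.Relation.Binary.Permutation.Setoid setoid using (↭-refl)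
open import Relation.Binary.Reasoning.Setoid setoid

-- Cauchy reals

-- The numbers in `B` come from folding the hexagon 1, ..., 6 along its antipodes. Let K be the
-- adjacency matrix of a triangle. On vectors with equal antipodal entries, suitably normalised, `B`
-- acts as the block matrix with rows (I - K, 2I, 0), (2I, -2I, 2I), (0, 2I, K); the weights √2 have
-- become 2. At each eigenvalue of K, which are 2 once and -1 twice, the resulting 3 × 3 matrix has
-- the eigenvalues -4, 0, 3. Vectors on the hexagon with opposite antipodal entries contribute 0, 0,
-- 3, whence the multiplicities 3, 5, 4.
--
-- The trace conditions on `B` amount to the one with i = 2: X vanishes on the support of `B`, so
-- tr(BX) = 0, and B³ = 12 B - B² reduces every higher power. Both halves of the theorem are tight
-- against each other: the X that commute with `B` and vanish at the diagonal and the edges form a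
-- line, nonzero because the SSP fails, and the single trace equation cuts it down to 0.

module ℚ-Solver = +-*-Solver

ι : ℤ → ℝ
ι n = fromℚ (fromℤ n)

fromℤ-+ : ∀ m n → fromℤ (m ℤ.+ n) ≡ fromℤ m ℚ.+ fromℤ n
fromℤ-+ m n = ℚₚ.toℚᵘ-injective (ℚᵘₚ.≃-trans
  (ℚᵘ.*≡* (≡.cong (ℤ._* ℤ.1ℤ) (≡.sym (≡.cong₂ ℤ._+_ (ℤₚ.*-identityʳ m) (ℤₚ.*-identityʳ n)))))
  (ℚᵘₚ.≃-sym (ℚₚ.toℚᵘ-homo-+ (fromℤ m) (fromℤ n))))

fromℤ-* : ∀ m n → fromℤ (m ℤ.* n) ≡ fromℤ m ℚ.* fromℤ n
fromℤ-* m n = ℚₚ.toℚᵘ-injective (ℚᵘₚ.≃-sym (ℚₚ.toℚᵘ-homo-* (fromℤ m) (fromℤ n)))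

fromℤ-neg : ∀ n → fromℤ (ℤ.- n) ≡ ℚ.- fromℤ n
fromℤ-neg (+ zero)     = ≡.refl
fromℤ-neg ℤ.+[1+ n ]   = ≡.refl
fromℤ-neg ℤ.-[1+ n ]   = ≡.refl

ι-homomorphism : CommutativeRing.rawRing ℤₚ.+-*-commutativeRing
  -Raw-AlmostCommutative⟶ fromCommutativeRing ℝ-commutativeRing
ι-homomorphism = record
  { ⟦_⟧    = ι
  ; +-homo = λ m n → pointwise λ _ → fromℤ-+ m n
  ; *-homo = λ m n → pointwise λ _ → fromℤ-* m n
  ; -‿homo = λ n → pointwise λ _ → fromℤ-neg n
  ; 0-homo = pointwise λ _ → ≡.refl
  ; 1-homo = pointwise λ _ → ≡.refl
  }

-- Coefficients are normalised in ℤ because the solver has to compare them, and equality of Cauchy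
-- reals is undecidable.
module Solver = RingSolver (CommutativeRing.rawRing ℤₚ.+-*-commutativeRing)
  (fromCommutativeRing ℝ-commutativeRing) ι-homomorphism
  (λ m n → Maybe.map (≈-reflexive ∘ ≡.cong ι) (dec⇒maybe (m ℤₚ.≟ n)))
open Solver using (solve; _:=_; _:+_; _:*_; _:-_; :-_; con)

-- Apartness from 0: a positive rational bound that the sequence eventually respects. Unlike `≉` it
-- carries data that one can divide by.
Apart : ℝ → Set
Apart x = ∃ λ δ → 0ℚ ℚ.< δ × ∃ λ N → ∀ n → N ℕ.≤ n → δ ℚ.≤ ∣ seq x n ∣

Bounded : ℚ → ℝ → Set
Bounded ε x = ∃ λ N → ∀ n → N ℕ.≤ n → ∣ seq x n ∣ ℚ.≤ ε

∣p∣≤∣p-q∣+∣q∣ : ∀ p q → ∣ p ∣ ℚ.≤ ∣ p ℚ.- q ∣ ℚ.+ ∣ q ∣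
∣p∣≤∣p-q∣+∣q∣ p q = ≡.subst (λ r → ∣ r ∣ ℚ.≤ ∣ p ℚ.- q ∣ ℚ.+ ∣ q ∣)
  (ℚ-Solver.solve 2 (λ a b → (a ℚ-Solver.:- b) ℚ-Solver.:+ b ℚ-Solver.:= a) ≡.refl p q)
  (ℚₚ.∣p+q∣≤∣p∣+∣q∣ (p ℚ.- q) q)

+-cancelˡ-≤ : ∀ p {q r} → p ℚ.+ q ℚ.≤ p ℚ.+ r → q ℚ.≤ r
+-cancelˡ-≤ p {q} {r} h = ≡.subst₂ ℚ._≤_ (cancel q) (cancel r) (ℚₚ.+-monoʳ-≤ (ℚ.- p) h)
  where
  cancel : ∀ q → ℚ.- p ℚ.+ (p ℚ.+ q) ≡ q
  cancel = ℚ-Solver.solve 2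
    (λ a b → ℚ-Solver.:- a ℚ-Solver.:+ (a ℚ-Solver.:+ b) ℚ-Solver.:= b) ≡.refl p

half-≤ : ∀ δ {r} → δ ℚ.≤ ½ ℚ.* δ ℚ.+ r → ½ ℚ.* δ ℚ.≤ r
half-≤ δ {r} h = +-cancelˡ-≤ (½ ℚ.* δ)
  (≡.subst (ℚ._≤ ½ ℚ.* δ ℚ.+ r) (≡.sym (halves δ)) h)

-- One rational term decides. Beyond N the sequence moves by at most ε/4, so ∣xₙ∣ stays below ε if
-- ∣x_N∣ ≤ ε/2, and above ε/4 otherwise. The two alternatives overlap, which is what makes the
-- choice computable.
bounded-or-apart : ∀ x ε → 0ℚ ℚ.< ε → Bounded ε x ⊎ Apart x
bounded-or-apart x ε 0<ε with cauchy x (½ ℚ.* (½ ℚ.* ε)) (halve (halve 0<ε))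
... | N , h with ∣ seq x N ∣ ℚₚ.≤? ½ ℚ.* ε
...   | yes small = inj₁ (N , λ n N≤n → ℚₚ.≤-trans
          (∣p∣≤∣p-q∣+∣q∣ (seq x n) (seq x N))
          (≡.subst (∣ seq x n ℚ.- seq x N ∣ ℚ.+ ∣ seq x N ∣ ℚ.≤_) (halves ε)
            (ℚₚ.+-mono-≤ (ℚₚ.≤-trans (h n N N≤n ℕₚ.≤-refl) δ≤½ε) small)))
  where
  δ≤½ε : ½ ℚ.* (½ ℚ.* ε) ℚ.≤ ½ ℚ.* ε
  δ≤½ε = ≡.subst₂ ℚ._≤_ (ℚₚ.+-identityʳ _) (halves (½ ℚ.* ε))
    (ℚₚ.+-monoʳ-≤ (½ ℚ.* (½ ℚ.* ε)) (ℚₚ.<⇒≤ (halve (halve 0<ε))))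
...   | no large = inj₂ (_ , halve (halve 0<ε) , N , λ n N≤n → half-≤ (½ ℚ.* ε)
            (ℚₚ.≤-trans (ℚₚ.<⇒≤ (ℚₚ.≰⇒> large))
              (ℚₚ.≤-trans (∣p∣≤∣p-q∣+∣q∣ (seq x N) (seq x n))
                (ℚₚ.+-monoˡ-≤ ∣ seq x n ∣ (h N n ℕₚ.≤-refl N≤n)))))

bounded⇒≈0 : ∀ {x} → (∀ ε → 0ℚ ℚ.< ε → Bounded ε x) → x ≈ 0ℝ
bounded⇒≈0 {x} h = mk≈ λ ε 0<ε → let N , k = h ε 0<ε in
  N , λ n N≤n → ≡.subst (λ p → ∣ p ∣ ℚ.≤ ε) (≡.sym (ℚₚ.+-identityʳ (seq x n))) (k n N≤n)

≈0⇒bounded : ∀ {x} → x ≈ 0ℝ → ∀ ε → 0ℚ ℚ.< ε → Bounded ε x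
≈0⇒bounded {x} x≈0 ε 0<ε = let N , k = close x≈0 ε 0<ε in
  N , λ n N≤n → ≡.subst (λ p → ∣ p ∣ ℚ.≤ ε) (ℚₚ.+-identityʳ (seq x n)) (k n N≤n)

¬apart⇒≈0 : ∀ {x} → ¬ Apart x → x ≈ 0ℝ
¬apart⇒≈0 {x} ¬apart = bounded⇒≈0 bounded
  where
  bounded : ∀ ε → 0ℚ ℚ.< ε → Bounded ε x
  bounded ε 0<ε with bounded-or-apart x ε 0<ε
  ... | inj₁ b = b
  ... | inj₂ a = contradiction a ¬apart

apart⇒≉0 : ∀ {x} → Apart x → x ≉ 0ℝ
apart⇒≉0 (δ , 0<δ , M , h) x≈0 =
  let N , k = ≈0⇒bounded x≈0 (½ ℚ.* δ) (halve 0<δ)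
      n     = M ℕ.⊔ N
      δ≤½δ  = ℚₚ.≤-trans (h n (ℕₚ.m≤m⊔n M N)) (k n (ℕₚ.m≤n⊔m M N))
  in ℚₚ.<-irrefl ≡.refl (ℚₚ.<-≤-trans (halve 0<δ) (half-≤ δ
       (≡.subst (δ ℚ.≤_) (≡.sym (ℚₚ.+-identityʳ (½ ℚ.* δ))) δ≤½δ)))

-- This licenses arguments by contradiction for every goal of the form x ≈ 0, in place of case
-- distinctions on undecidable equality.
≈0-stable : ∀ {x} → ¬ (x ≉ 0ℝ) → x ≈ 0ℝ
≈0-stable ¬¬x≈0 = ¬apart⇒≈0 λ apart → ¬¬x≈0 (apart⇒≉0 apart)

apart-* : ∀ {x y} → Apart x → x * y ≈ 0ℝ → y ≈ 0ℝ
apart-* {x} {y} (δ , 0<δ , M , h) xy≈0 = bounded⇒≈0 λ ε 0<ε →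
  let 0<δε  = ≡.subst (ℚ._< δ ℚ.* ε) (ℚₚ.*-zeroʳ δ) (ℚₚ.*-monoʳ-<-pos δ {{ℚ.positive 0<δ}} 0<ε)
      N , k = ≈0⇒bounded xy≈0 (δ ℚ.* ε) 0<δε
  in M ℕ.⊔ N , λ n p → ℚₚ.*-cancelˡ-≤-pos δ {{ℚ.positive 0<δ}} (ℚₚ.≤-trans
       (ℚₚ.*-monoʳ-≤-nonNeg ∣ seq y n ∣ {{ℚₚ.∣-∣-nonNeg (seq y n)}} (h n (≤ˡ p)))
       (≡.subst (ℚ._≤ δ ℚ.* ε) (ℚₚ.∣p*q∣≡∣p∣*∣q∣ (seq x n) (seq y n)) (k n (≤ʳ {M} p))))

-- A mere x ≉ 0 yields no inverse. But if y ≉ 0, then x cannot be apart from 0, hence x ≈ 0, a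
-- contradiction; stability does the rest.
*-cancel-≉0 : ∀ {x y} → x ≉ 0ℝ → x * y ≈ 0ℝ → y ≈ 0ℝ
*-cancel-≉0 x≉0 xy≈0 = ≈0-stable λ y≉0 → x≉0 (¬apart⇒≈0 λ apart → y≉0 (apart-* apart xy≈0))

-- If ∣x∣ stays below δ/2 while ∣x - y∣ ≥ δ, the triangle inequality leaves at least δ/2 for ∣y∣.
apart-cotransitive : ∀ x y → Apart (x - y) → Apart x ⊎ Apart y
apart-cotransitive x y (δ , 0<δ , M , h) with bounded-or-apart x (½ ℚ.* δ) (halve 0<δ)
... | inj₂ apart   = inj₁ apart
... | inj₁ (N , k) = inj₂ (½ ℚ.* δ , halve 0<δ , M ℕ.⊔ N , λ n p → half-≤ δ
        (ℚₚ.≤-trans (h n (≤ˡ p))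
          (ℚₚ.≤-trans (ℚₚ.∣p-q∣≤∣p∣+∣q∣ (seq x n) (seq y n))
            (ℚₚ.+-monoˡ-≤ ∣ seq y n ∣ (k n (≤ʳ {M} p))))))

fromℚ-apart : ∀ {q} → q ≢ 0ℚ → Apart (fromℚ q)
fromℚ-apart {q} q≢0 = ∣ q ∣
  , ℚₚ.≰⇒> (λ ∣q∣≤0 → q≢0 (ℚₚ.∣p∣≡0⇒p≡0 q (ℚₚ.≤-antisym ∣q∣≤0 (ℚₚ.0≤∣p∣ q))))
  , 0 , λ _ _ → ℚₚ.≤-refl

apart-resp-≈ : ∀ {x y} → x ≈ y → Apart x → Apart y
apart-resp-≈ {x} {y} x≈y (δ , 0<δ , M , h) =
  let N , k = close x≈y (½ ℚ.* δ) (halve 0<δ)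
  in ½ ℚ.* δ , halve 0<δ , M ℕ.⊔ N , λ n p → half-≤ δ
       (ℚₚ.≤-trans (h n (≤ˡ p))
         (ℚₚ.≤-trans (∣p∣≤∣p-q∣+∣q∣ (seq x n) (seq y n))
           (ℚₚ.+-monoˡ-≤ ∣ seq y n ∣ (k n (≤ʳ {M} p)))))

-- A vanishing product of reals does not tell which factor vanishes. A known gap between the factors
-- does: one of them is apart from 0 and can be cancelled.
product-zero : ∀ {x y c} → x - y ≈ c → Apart c → x * y ≈ 0ℝ → x ≈ 0ℝ ⊎ y ≈ 0ℝ
product-zero {x} {y} x-y≈c apart xy≈0 =
  [ (λ x-apart → inj₂ (apart-* x-apart xy≈0))
  , (λ y-apart → inj₁ (apart-* y-apart (≈-trans (*-comm y x) xy≈0)))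
  ]′ (apart-cotransitive x y (apart-resp-≈ (≈-sym x-y≈c) apart))

-- Linear algebra over ℝ

1≉0 : 1ℝ ≉ 0ℝ
1≉0 = apart⇒≉0 (fromℚ-apart {1ℚ} λ ())

x-y≈0⇒x≈y : ∀ {x y} → x - y ≈ 0ℝ → x ≈ y
x-y≈0⇒x≈y {x} {y} h = begin
  x            ≈⟨ solve 2 (λ x y → x := (x :- y) :+ y) ≈-refl x y ⟩
  (x - y) + y  ≈⟨ +-congʳ h ⟩
  0ℝ + y       ≈⟨ +-identityˡ y ⟩
  y            ∎

x≈y⇒x-y≈0 : ∀ {x y} → x ≈ y → x - y ≈ 0ℝ
x≈y⇒x-y≈0 {x} {y} h = ≈-trans (+-congʳ h) (-‿inverseʳ y)

sum-zero : ∀ {n} {t : Vector ℝ n} → (∀ i → t i ≈ 0ℝ) → sum t ≈ 0ℝ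
sum-zero {n} h = ≈-trans (sum-cong-≋ h) (sum-replicate-zero n)

sum-linear : ∀ {n} a b (s t : Vector ℝ n) →
  sum (λ i → a * s i + b * t i) ≈ a * sum s + b * sum t
sum-linear a b s t = begin
  sum (λ i → a * s i + b * t i)              ≈⟨ ∑-distrib-+ (λ i → a * s i) (λ i → b * t i) ⟩
  sum (λ i → a * s i) + sum (λ i → b * t i)  ≈⟨ +-cong (*-distribˡ-sum a s) (*-distribˡ-sum b t) ⟨
  a * sum s + b * sum t                      ∎

sum-neg : ∀ {n} (t : Vector ℝ n) → sum (λ i → - t i) ≈ - sum t
sum-neg t = begin
  sum (λ i → - t i)       ≈⟨ sum-cong-≋ (λ i → neg (t i)) ⟩
  sum (λ i → -1ℝ * t i)   ≈⟨ *-distribˡ-sum -1ℝ t ⟨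
  -1ℝ * sum t             ≈⟨ neg (sum t) ⟨
  - sum t                 ∎
  where
  neg : ∀ x → - x ≈ -1ℝ * x
  neg = solve 1 (λ x → :- x := :- con (+ 1) :* x) ≈-refl

sum-- : ∀ {n} (s t : Vector ℝ n) → sum (λ i → s i - t i) ≈ sum s - sum t
sum-- s t = ≈-trans (∑-distrib-+ s (λ i → - t i)) (+-congˡ (sum-neg t))

sum-I : ∀ {n} (t : Vector ℝ n) k → sum (λ i → I k i * t i) ≈ t k
sum-I {suc n} t zero = begin
  1ℝ * t zero + sum (λ i → I zero (suc i) * t (suc i))
    ≈⟨ +-cong (*-identityˡ (t zero)) (sum-zero λ i → zeroˡ (t (suc i))) ⟩
  t zero + 0ℝ  ≈⟨ +-identityʳ (t zero) ⟩
  t zero       ∎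
sum-I {suc n} t (suc k) = begin
  0ℝ * t zero + sum (λ i → I (suc k) (suc i) * t (suc i))
    ≈⟨ +-cong (zeroˡ (t zero)) (sum-cong-≋ λ i → *-congʳ {x = t (suc i)} (I-suc k i)) ⟩
  0ℝ + sum (λ i → I k i * t (suc i))  ≈⟨ +-identityˡ _ ⟩
  sum (λ i → I k i * t (suc i))       ≈⟨ sum-I (t ∘ suc) k ⟩
  t (suc k)                           ∎
  where
  I-suc : ∀ (i j : Fin n) → I (suc i) (suc j) ≈ I i j
  I-suc i j with i ≟ j
  ... | yes _ = ≈-refl
  ... | no  _ = ≈-refl

-- Column elimination.  An unknown is eliminated with a row whose
-- coefficient p there is nonzero; scaling the remaining unknowns by p
-- avoids division.
underdetermined : ∀ m (M : Fin m → Vector ℝ (suc m)) →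
  ¬ (∀ x → (∀ i → sum (λ j → M i j * x j) ≈ 0ℝ) → x ≋ 0ᵛ)
underdetermined zero M injective =
  1≉0 (injective (λ _ → 1ℝ) (λ ()) zero)
underdetermined (suc m) M injective =
  1≉0 (injective e₀ e₀-solves zero)
  where
  -- A nonzero entry in the first column would leave an injective system of m equations in m + 1
  -- unknowns, against the induction hypothesis. So the first column vanishes and `e₀` is a nonzero
  -- solution.
  noPivot : ∀ i → ¬ (M i zero ≉ 0ℝ)
  noPivot i p≉0 = underdetermined m M′ injective′
    where
    p : ℝ
    p = M i zero

    M′ : Fin m → Vector ℝ (suc m)
    M′ k j = p * M (punchIn i k) (suc j) - M (punchIn i k) zero * M i (suc j)

    injective′ : ∀ x → (∀ k → sum (λ j → M′ k j * x j) ≈ 0ℝ) → x ≋ 0ᵛ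
    injective′ x M′x≈0 j = *-cancel-≉0 p≉0 (injective x⁺ Mx⁺≈0 (suc j))
      where
      S : Fin (suc m) → ℝ
      S k = sum λ j → M k (suc j) * x j

      -- Back substitution with the denominator p cleared: the eliminated unknown is -S i, the
      -- others are scaled by p, so that row i cancels.
      x⁺ : Vector ℝ (suc (suc m))
      x⁺ = (- S i) ∷ᶠ λ j → p * x j

      Mx⁺ : ∀ k → sum (λ j → M k j * x⁺ j) ≈ p * S k - M k zero * S i
      Mx⁺ k = begin
        M k zero * - S i + sum (λ j → M k (suc j) * (p * x j))
          ≈⟨ +-congˡ (sum-cong-≋ λ j → solve 3 (λ a p x → a :* (p :* x) := p :* (a :* x))
               ≈-refl (M k (suc j)) p (x j)) ⟩
        M k zero * - S i + sum (λ j → p * (M k (suc j) * x j))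
          ≈⟨ +-congˡ (*-distribˡ-sum p λ j → M k (suc j) * x j) ⟨
        M k zero * - S i + p * S k
          ≈⟨ solve 3 (λ a s t → a :* :- s :+ t := t :- a :* s) ≈-refl (M k zero) (S i) (p * S k) ⟩
        p * S k - M k zero * S i ∎

      M′x : ∀ k → sum (λ j → M′ k j * x j) ≈ p * S (punchIn i k) - M (punchIn i k) zero * S i
      M′x k = begin
        sum (λ j → M′ k j * x j)
          ≈⟨ sum-cong-≋ (λ j → solve 5 (λ p a b c x →
               (p :* a :- b :* c) :* x := p :* (a :* x) :- b :* (c :* x)) ≈-refl
               p (M l (suc j)) (M l zero) (M i (suc j)) (x j)) ⟩
        sum (λ j → p * (M l (suc j) * x j) - M l zero * (M i (suc j) * x j))
          ≈⟨ sum-- (λ j → p * (M l (suc j) * x j)) (λ j → M l zero * (M i (suc j) * x j)) ⟩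
        sum (λ j → p * (M l (suc j) * x j)) - sum (λ j → M l zero * (M i (suc j) * x j))
          ≈⟨ +-cong (*-distribˡ-sum p (λ j → M l (suc j) * x j))
               (-‿cong (*-distribˡ-sum (M l zero) (λ j → M i (suc j) * x j))) ⟨
        p * S l - M l zero * S i ∎
        where l = punchIn i k

      Mx⁺≈0 : ∀ k → sum (λ j → M k j * x⁺ j) ≈ 0ℝ
      Mx⁺≈0 k with i ≟ k
      ... | yes ≡.refl = ≈-trans (Mx⁺ i) (-‿inverseʳ (p * S i))
      ... | no i≢k = ≡.subst (λ k → sum (λ j → M k j * x⁺ j) ≈ 0ℝ) (punchIn-punchOut i≢k)
              (≈-trans (Mx⁺ (punchIn i (punchOut i≢k)))
                (≈-trans (≈-sym (M′x (punchOut i≢k))) (M′x≈0 (punchOut i≢k))))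

  e₀ : Vector ℝ (suc (suc m))
  e₀ = 1ℝ ∷ᶠ 0ᵛ

  e₀-solves : ∀ i → sum (λ j → M i j * e₀ j) ≈ 0ℝ
  e₀-solves i = begin
    M i zero * 1ℝ + sum (λ j → M i (suc j) * 0ℝ)
      ≈⟨ +-cong (*-congʳ (≈0-stable (noPivot i))) (sum-zero λ j → zeroʳ (M i (suc j))) ⟩
    0ℝ * 1ℝ + 0ℝ  ≈⟨ solve 1 (λ x → con (+ 0) :* x :+ con (+ 0) := con (+ 0)) ≈-refl 1ℝ ⟩
    0ℝ            ∎

∙ᵛ-cong : ∀ {n} (A : Matrix n) {v w} → v ≋ w → A ∙ᵛ v ≋ A ∙ᵛ w
∙ᵛ-cong A v≋w i = sum-cong-≋ λ k → *-congˡ {x = A i k} (v≋w k)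

∙ᵛ-sum : ∀ {n q} (A : Matrix n) (w : Fin q → Vector ℝ n) →
  A ∙ᵛ (λ i → sum λ k → w k i) ≋ λ i → sum λ k → (A ∙ᵛ w k) i
∙ᵛ-sum A w i = begin
  sum (λ l → A i l * sum (λ k → w k l))  ≈⟨ sum-cong-≋ (λ l → *-distribˡ-sum (A i l) (λ k → w k l)) ⟩
  sum (λ l → sum (λ k → A i l * w k l))  ≈⟨ ∑-comm (λ l k → A i l * w k l) ⟩
  sum (λ k → sum (λ l → A i l * w k l))  ∎

∙ᵛ-scale : ∀ {n} (A : Matrix n) c v → A ∙ᵛ (λ i → c * v i) ≋ λ i → c * (A ∙ᵛ v) i
∙ᵛ-scale A c v i = begin
  sum (λ l → A i l * (c * v l))
    ≈⟨ sum-cong-≋ (λ l → solve 3 (λ a c v → a :* (c :* v) := c :* (a :* v)) ≈-refl (A i l) c (v l)) ⟩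
  sum (λ l → c * (A i l * v l))  ≈⟨ *-distribˡ-sum c (λ l → A i l * v l) ⟨
  c * sum (λ l → A i l * v l)    ∎

eigenspace-scale : ∀ {n} (A : Matrix n) {μ} c {v} → Eigenspace A μ v → Eigenspace A μ (λ i → c * v i)
eigenspace-scale A {μ} c {v} Av i = begin
  (A ∙ᵛ (λ i → c * v i)) i  ≈⟨ ∙ᵛ-scale A c v i ⟩
  c * (A ∙ᵛ v) i            ≈⟨ *-congˡ (Av i) ⟩
  c * (μ * v i)             ≈⟨ solve 3 (λ c m v → c :* (m :* v) := m :* (c :* v)) ≈-refl c μ (v i) ⟩
  μ * (c * v i)             ∎

eigenspace-linComb : ∀ {n d} (A : Matrix n) {μ} c {b : Fin d → Vector ℝ n} →
  (∀ k → Eigenspace A μ (b k)) → Eigenspace A μ (linComb c b)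
eigenspace-linComb A {μ} c {b} Ab i = begin
  (A ∙ᵛ linComb c b) i                        ≈⟨ ∙ᵛ-sum A (λ k i → c k * b k i) i ⟩
  sum (λ k → (A ∙ᵛ (λ i → c k * b k i)) i)    ≈⟨ sum-cong-≋ (λ k → eigenspace-scale A (c k) (Ab k) i) ⟩
  sum (λ k → μ * (c k * b k i))               ≈⟨ *-distribˡ-sum μ (λ k → c k * b k i) ⟨
  μ * linComb c b i                           ∎

-- Applying A - μ₀ to the vanishing sum removes the first vector and multiplies each other one by
-- the nonzero μₖ - μ₀. The scaled vectors are still eigenvectors, so induction makes them vanish,
-- and then the first one as well.
eigenvectors-independent : ∀ {n q} (A : Matrix n) (μ : Vector ℝ q) →
  (∀ {k l} → k ≢ l → μ k - μ l ≉ 0ℝ) →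
  (w : Fin q → Vector ℝ n) → (∀ k → Eigenspace A (μ k) (w k)) →
  (λ i → sum λ k → w k i) ≋ 0ᵛ → ∀ k → w k ≋ 0ᵛ
eigenvectors-independent {q = zero}  A μ distinct w Aw Σw≈0 ()
eigenvectors-independent {q = suc q} A μ distinct w Aw Σw≈0 = λ
  { zero    i → begin
      w zero i                            ≈⟨ +-identityʳ (w zero i) ⟨
      w zero i + 0ℝ                       ≈⟨ +-congˡ (sum-zero λ k → tail≈0 k i) ⟨
      w zero i + sum (λ k → w (suc k) i)  ≈⟨ Σw≈0 i ⟩
      0ℝ                                  ∎
  ; (suc k) → tail≈0 k
  }
  where
  scaled : Fin q → Vector ℝ _
  scaled k i = (μ (suc k) - μ zero) * w (suc k) i

  Σμw : ∀ i → sum (λ k → μ k * w k i) ≈ 0ℝ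
  Σμw i = begin
    sum (λ k → μ k * w k i)            ≈⟨ sum-cong-≋ (λ k → Aw k i) ⟨
    sum (λ k → (A ∙ᵛ w k) i)           ≈⟨ ∙ᵛ-sum A w i ⟨
    (A ∙ᵛ (λ i → sum λ k → w k i)) i   ≈⟨ ∙ᵛ-cong A Σw≈0 i ⟩
    sum (λ l → A i l * 0ℝ)             ≈⟨ sum-zero (λ l → zeroʳ (A i l)) ⟩
    0ℝ                                 ∎

  Σscaled : ∀ i → sum (λ k → scaled k i) ≈ 0ℝ
  Σscaled i = begin
    sum (λ k → scaled k i)
      ≈⟨ sum-cong-≋ (λ k → solve 3 (λ m m₀ w → (m :- m₀) :* w := m :* w :- m₀ :* w)
           ≈-refl (μ (suc k)) (μ zero) (w (suc k) i)) ⟩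
    sum (λ k → μ (suc k) * w (suc k) i - μ zero * w (suc k) i)
      ≈⟨ sum-- (λ k → μ (suc k) * w (suc k) i) (λ k → μ zero * w (suc k) i) ⟩
    sum (λ k → μ (suc k) * w (suc k) i) - sum (λ k → μ zero * w (suc k) i)
      ≈⟨ +-congˡ (-‿cong (*-distribˡ-sum (μ zero) (λ k → w (suc k) i))) ⟨
    S - μ zero * T
      ≈⟨ solve 4 (λ m w s t → s :- m :* t := (m :* w :+ s) :- m :* (w :+ t))
           ≈-refl (μ zero) (w zero i) S T ⟩
    (μ zero * w zero i + S) - μ zero * (w zero i + T)
      ≈⟨ +-cong (Σμw i) (-‿cong (*-congˡ (Σw≈0 i))) ⟩
    0ℝ - μ zero * 0ℝ
      ≈⟨ solve 1 (λ m → con (+ 0) :- m :* con (+ 0) := con (+ 0)) ≈-refl (μ zero) ⟩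
    0ℝ ∎
    where
    S T : ℝ
    S = sum λ k → μ (suc k) * w (suc k) i
    T = sum λ k → w (suc k) i

  tail≈0 : ∀ k → w (suc k) ≋ 0ᵛ
  tail≈0 k i = *-cancel-≉0 (distinct λ ())
    (eigenvectors-independent A (μ ∘ suc) (λ k≢l → distinct (k≢l ∘ suc-injective))
      scaled (λ k → eigenspace-scale A (μ (suc k) - μ zero) (Aw (suc k))) Σscaled k i)

-- "Linear" asks for the coefficients, so that a family of linear forms
-- is a matrix.
Linear : ∀ {n} → (Vector ℝ n → ℝ) → Set
Linear {n} f = ∃ λ (a : Vector ℝ n) → ∀ x → sum (λ j → a j * x j) ≈ f x

linear-coordinate : ∀ {n} (k : Fin n) → Linear (λ x → x k)
linear-coordinate k = I k , λ x → sum-I x k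

linear-*ʳ : ∀ {n f} c → Linear {n} f → Linear (λ x → f x * c)
linear-*ʳ {f = f} c (a , eq) = (λ j → a j * c) , λ x → begin
  sum (λ j → a j * c * x j)
    ≈⟨ sum-cong-≋ (λ j → solve 3 (λ a c x → a :* c :* x := (a :* x) :* c) ≈-refl (a j) c (x j)) ⟩
  sum (λ j → a j * x j * c)    ≈⟨ *-distribʳ-sum c (λ j → a j * x j) ⟨
  sum (λ j → a j * x j) * c    ≈⟨ *-congʳ (eq x) ⟩
  f x * c                      ∎

linear-sum : ∀ {m n} {f : Fin m → Vector ℝ n → ℝ} →
  (∀ k → Linear (f k)) → Linear (λ x → sum λ k → f k x)
linear-sum {f = f} lin = (λ j → sum λ k → proj₁ (lin k) j) , λ x → begin
  sum (λ j → sum (λ k → proj₁ (lin k) j) * x j)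
    ≈⟨ sum-cong-≋ (λ j → *-distribʳ-sum (x j) (λ k → proj₁ (lin k) j)) ⟩
  sum (λ j → sum (λ k → proj₁ (lin k) j * x j))  ≈⟨ ∑-comm (λ j k → proj₁ (lin k) j * x j) ⟩
  sum (λ k → sum (λ j → proj₁ (lin k) j * x j))  ≈⟨ sum-cong-≋ (λ k → proj₂ (lin k) x) ⟩
  sum (λ k → f k x)                              ∎

underdetermined-forms : ∀ {m} (f : Fin m → Vector ℝ (suc m) → ℝ) → (∀ i → Linear (f i)) →
  ¬ (∀ x → (∀ i → f i x ≈ 0ℝ) → x ≋ 0ᵛ)
underdetermined-forms {m} f lin injective = underdetermined m (λ i → proj₁ (lin i))
  λ x Mx≈0 → injective x λ i → ≈-trans (≈-sym (proj₂ (lin i) x)) (Mx≈0 i)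

-- The (i , j) entry of U S Uᵀ, where the columns of U are the b a.
congruence : ∀ {n d} → (Fin d → Vector ℝ n) → (Fin d → Fin d → ℝ) → Matrix n
congruence b s i j = linComb (λ a → linComb (s a) b j) b i

congruence-symmetric : ∀ {n d} (b : Fin d → Vector ℝ n) {s} →
  (∀ a a′ → s a a′ ≈ s a′ a) → IsSymmetric (congruence b s)
congruence-symmetric b {s} s-sym i j = begin
  sum (λ a → sum (λ a′ → s a a′ * b a′ j) * b a i)
    ≈⟨ sum-cong-≋ (λ a → *-distribʳ-sum (b a i) (λ a′ → s a a′ * b a′ j)) ⟩
  sum (λ a → sum (λ a′ → s a a′ * b a′ j * b a i))    ≈⟨ ∑-comm (λ a a′ → s a a′ * b a′ j * b a i) ⟩
  sum (λ a′ → sum (λ a → s a a′ * b a′ j * b a i))    ≈⟨ sum-cong-≋ (λ a′ → sum-cong-≋ λ a →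
      ≈-trans (*-congʳ {b a i} (*-congʳ {b a′ j} (s-sym a a′)))
        (solve 3 (λ s x y → s :* x :* y := s :* y :* x) ≈-refl (s a′ a) (b a′ j) (b a i))) ⟩
  sum (λ a′ → sum (λ a → s a′ a * b a i * b a′ j))
    ≈⟨ sum-cong-≋ (λ a′ → *-distribʳ-sum (b a′ j) (λ a → s a′ a * b a i)) ⟨
  sum (λ a′ → sum (λ a → s a′ a * b a i) * b a′ j)    ∎

-- The unknown index k a a′ stands at the entries (a , a′) and (a′ , a) of
-- S k; there is one unknown more than there are constrained positions.
module _ {n q N} (A : Matrix n) (A-sym : IsSymmetric A)
  (μ : Vector ℝ q) (distinct : ∀ {k l} → k ≢ l → μ k - μ l ≉ 0ℝ)
  (d : Fin q → ℕ) (U : ∀ k → Fin (d k) → Vector ℝ n)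
  (U-eigen : ∀ k a → Eigenspace A (μ k) (U k a))
  (U-independent : ∀ k → LinearlyIndependent (U k))
  (index : ∀ k → Fin (d k) → Fin (d k) → Fin (suc N))
  (index-sym : ∀ k a a′ → index k a a′ ≡ index k a′ a)
  (index-surjective : ∀ p → ∃ λ k → ∃ λ a → ∃ λ a′ → index k a a′ ≡ p)
  (position : Fin N → Fin n × Fin n)
  (covered : ∀ i j → A i j ≈ 0ℝ × i ≢ j ⊎ ∃ λ p → position p ≡ (i , j) ⊎ position p ≡ (j , i))
  where

  private
    S : Vector ℝ (suc N) → ∀ k → Fin (d k) → Fin (d k) → ℝ
    S x k a a′ = x (index k a a′)

    component : Vector ℝ (suc N) → Fin q → Matrix n
    component x k = congruence (U k) (S x k)

    X : Vector ℝ (suc N) → Matrix n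
    X x i j = sum λ k → component x k i j

    component-symmetric : ∀ x k → IsSymmetric (component x k)
    component-symmetric x k = congruence-symmetric (U k) λ a a′ →
      ≈-reflexive (≡.cong x (index-sym k a a′))

    component-eigen : ∀ x k j → Eigenspace A (μ k) (λ i → component x k i j)
    component-eigen x k j = eigenspace-linComb A (λ a → linComb (S x k a) (U k) j) (U-eigen k)

    X-symmetric : ∀ x → IsSymmetric (X x)
    X-symmetric x i j = sum-cong-≋ λ k → component-symmetric x k i j

    AX : ∀ x i j → (A · X x) i j ≈ sum λ k → μ k * component x k i j
    AX x i j = ≈-trans (∙ᵛ-sum A (λ k i → component x k i j) i)
      (sum-cong-≋ λ k → component-eigen x k j i)

    -- Every component is symmetric with columns in the μₖ-eigenspace, so AX = Σ μₖ · component is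
    -- symmetric. As A and X are symmetric too, XA is the transpose of AX.
    X-commutes : ∀ x → ⟦ A , X x ⟧ ≋ᴹ O
    X-commutes x i j = x≈y⇒x-y≈0 (begin
      (A · X x) i j                           ≈⟨ AX x i j ⟩
      sum (λ k → μ k * component x k i j)
        ≈⟨ sum-cong-≋ (λ k → *-congˡ {μ k} (component-symmetric x k i j)) ⟩
      sum (λ k → μ k * component x k j i)     ≈⟨ AX x j i ⟨
      sum (λ l → A j l * X x l i)
        ≈⟨ sum-cong-≋ (λ l → ≈-trans (*-cong (A-sym j l) (X-symmetric x l i)) (*-comm (A l j) (X x i l))) ⟩
      sum (λ l → X x i l * A l j)             ∎)

    -- Independence is used three times: between eigenspaces to isolate one component, then for the
    -- basis of that eigenspace to strip U from the left of U S Uᵀ, and again to strip Uᵀ from the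
    -- right.
    X-injective : ∀ x → X x ≋ᴹ O → x ≋ 0ᵛ
    X-injective x X≈0 p with index-surjective p
    ... | k , a , a′ , ≡.refl = U-independent k (S x k a) row≈0 a′
      where
      component≈0 : ∀ j → (λ i → component x k i j) ≋ 0ᵛ
      component≈0 j = eigenvectors-independent A μ distinct (λ k i → component x k i j)
        (λ k → component-eigen x k j) (λ i → X≈0 i j) k

      row≈0 : linComb (S x k a) (U k) ≋ 0ᵛ
      row≈0 j = U-independent k (λ a → linComb (S x k a) (U k) j) (component≈0 j) a

    entry : Fin N → Vector ℝ (suc N) → ℝ
    entry p x = X x (proj₁ (position p)) (proj₂ (position p))

    entry-linear : ∀ p → Linear (entry p)
    entry-linear p = linear-sum λ k → linear-sum λ a → linear-*ʳ (U k a (proj₁ (position p)))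
      (linear-sum λ a′ → linear-*ʳ (U k a′ (proj₂ (position p))) (linear-coordinate (index k a a′)))

  -- Under the SSP, the N entries of X at the listed positions would determine all N + 1 unknowns.
  ¬SSP-by-counting : ¬ SSP A
  ¬SSP-by-counting ssp = underdetermined-forms entry entry-linear λ x entries≈0 →
    X-injective x (ssp (X x) (X-symmetric x) (A⊙X x entries≈0) (I⊙X x entries≈0) (X-commutes x))
    where
    covered⇒≈0 : ∀ x → (∀ p → entry p x ≈ 0ℝ) → ∀ {i j} →
      (∃ λ p → position p ≡ (i , j) ⊎ position p ≡ (j , i)) → X x i j ≈ 0ℝ
    covered⇒≈0 x entries≈0 (p , inj₁ eq) =
      ≡.subst (λ (i , j) → X x i j ≈ 0ℝ) eq (entries≈0 p)
    covered⇒≈0 x entries≈0 {i} {j} (p , inj₂ eq) = ≈-trans (X-symmetric x i j)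
      (≡.subst (λ (i , j) → X x i j ≈ 0ℝ) eq (entries≈0 p))

    A⊙X : ∀ x → (∀ p → entry p x ≈ 0ℝ) → A ⊙ X x ≋ᴹ O
    A⊙X x entries≈0 i j with covered i j
    ... | inj₁ (a≈0 , _) = ≈-trans (*-congʳ a≈0) (zeroˡ (X x i j))
    ... | inj₂ c         = ≈-trans (*-congˡ (covered⇒≈0 x entries≈0 c)) (zeroʳ (A i j))

    I⊙X : ∀ x → (∀ p → entry p x ≈ 0ℝ) → I ⊙ X x ≋ᴹ O
    I⊙X x entries≈0 i j with i ≟ j | covered i j
    ... | no  _   | _                = zeroˡ (X x i j)
    ... | yes i≡j | inj₁ (_ , i≢j)   = contradiction i≡j i≢j
    ... | yes _   | inj₂ c           = ≈-trans (*-congˡ (covered⇒≈0 x entries≈0 c)) (zeroʳ 1ℝ)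

-- The graph H

<⇒apart : ∀ {x y} → x < y → Apart (y - x)
<⇒apart {x} {y} (mk< δ 0<δ N sep) = δ , 0<δ , N , λ n N≤n → ℚₚ.≤-trans
  (+-cancelˡ-≤ (seq x n) (≡.subst (seq x n ℚ.+ δ ℚ.≤_) (≡.sym (cancel (seq x n) (seq y n))) (sep n N≤n)))
  (p≤∣p∣ (seq y n ℚ.- seq x n))
  where
  cancel : ∀ p q → p ℚ.+ (q ℚ.- p) ≡ q
  cancel = ℚ-Solver.solve 2
    (λ p q → p ℚ-Solver.:+ (q ℚ-Solver.:- p) ℚ-Solver.:= q) ≡.refl
  p≤∣p∣ : ∀ p → p ℚ.≤ ℚ.∣ p ∣
  p≤∣p∣ p = [ (λ 0≤p → ℚₚ.≤-reflexive (≡.sym (ℚₚ.0≤p⇒∣p∣≡p 0≤p)))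
            , (λ p≤0 → ℚₚ.≤-trans p≤0 (ℚₚ.0≤∣p∣ p)) ]′ (ℚₚ.≤-total 0ℚ p)

increasing⇒distinct : ∀ {q} (x : Vector ℝ q) → (∀ {i j} → i Fin.< j → x i < x j) →
  ∀ {i j} → i ≢ j → x i - x j ≉ 0ℝ
increasing⇒distinct x increasing {i} {j} i≢j with <-cmp i j
... | tri< i<j _ _ = λ xi-xj≈0 → apart⇒≉0 (<⇒apart (increasing i<j))
        (x≈y⇒x-y≈0 (≈-sym (x-y≈0⇒x≈y xi-xj≈0)))
... | tri≈ _ i≡j _ = contradiction i≡j i≢j
... | tri> _ _ j<i = apart⇒≉0 (<⇒apart (increasing j<i))

multiplicities : Vec ℕ 3
multiplicities = 3 ∷ 5 ∷ 4 ∷ []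

triangle : ℕ → ℕ
triangle zero    = 0
triangle (suc n) = suc n ℕ.+ triangle n

-- The triangular numbers of 3, 5 and 4 add up to 31 = 18 + 12 + 1.
symmetricIndex : ∀ k → Fin (lookup multiplicities k) → Fin (lookup multiplicities k) → Fin 31
-- The blocks start at 0, 6 = triangle 3 and 21 = 6 + triangle 5. Inside a block the lower triangle
-- is listed row by row, so row r starts at `triangle r`; maximum and minimum make the pair
-- unordered. The largest value is 21 + 6 + 3 = 30, so `mod 31` changes no value and only supplies
-- the bound.
symmetricIndex k a a′ = (lookup (0 ∷ 6 ∷ 21 ∷ []) k
  ℕ.+ (triangle (toℕ a ℕ.⊔ toℕ a′) ℕ.+ (toℕ a ℕ.⊓ toℕ a′))) mod 31

symmetricIndex-sym : ∀ k a a′ → symmetricIndex k a a′ ≡ symmetricIndex k a′ a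
symmetricIndex-sym k a a′ = ≡.cong₂ (λ u v → (lookup (0 ∷ 6 ∷ 21 ∷ []) k ℕ.+ (triangle u ℕ.+ v)) mod 31)
  (ℕₚ.⊔-comm (toℕ a) (toℕ a′)) (ℕₚ.⊓-comm (toℕ a) (toℕ a′))

symmetricIndex-surjective : ∀ p → ∃ λ k → ∃ λ a → ∃ λ a′ → symmetricIndex k a a′ ≡ p
symmetricIndex-surjective =
  from-yes (all? λ p → any? λ k → any? λ a → any? λ a′ → symmetricIndex k a a′ ≟ p)

open Graph H using (Adj)

Adj? : ∀ i j → Dec (Adj i j)
Adj? i j = ((suc (toℕ i) , suc (toℕ j)) ∈? H-edges) ⊎-dec ((suc (toℕ j) , suc (toℕ i)) ∈? H-edges)
  where open DecMembership (Productₚ.≡-dec ℕₚ._≟_ ℕₚ._≟_) using (_∈?_)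

InSupport : Fin 12 × Fin 12 → Set
InSupport (i , j) = i ≡ j ⊎ (i Fin.< j × Adj i j)

inSupport? : ∀ p → Dec (InSupport p)
inSupport? (i , j) = (i ≟ j) ⊎-dec ((i Finₚ.<? j) ×-dec Adj? i j)

-- Its length evaluates to 12 + 18 = 30. This is where the count is made: `¬SSP-H` type checks
-- because `Fin 31` has one element more.
supportPositions : List (Fin 12 × Fin 12)
supportPositions = List.filter inSupport? (List.cartesianProduct (List.allFin 12) (List.allFin 12))

∈-supportPositions : ∀ {i j} → InSupport (i , j) → (i , j) ∈ supportPositions
∈-supportPositions {i} {j} = ∈-filter⁺ inSupport? (∈-cartesianProduct⁺ (∈-allFin i) (∈-allFin j))

∈⇒lookup : ∀ {A : Set} {x : A} {xs} → x ∈ xs → ∃ λ p → List.lookup xs p ≡ x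
∈⇒lookup x∈xs = Any.index x∈xs , ≡.sym (Anyₚ.lookup-index x∈xs)

supportPositions-complete : ∀ i j → i ≡ j ⊎ Adj i j →
  ∃ λ p → List.lookup supportPositions p ≡ (i , j) ⊎ List.lookup supportPositions p ≡ (j , i)
supportPositions-complete i j related with related | <-cmp i j
... | inj₁ ≡.refl | _             = Product.map₂ inj₁ (∈⇒lookup (∈-supportPositions (inj₁ ≡.refl)))
... | inj₂ i~j    | tri< i<j _ _  = Product.map₂ inj₁ (∈⇒lookup (∈-supportPositions (inj₂ (i<j , i~j))))
... | inj₂ i~i    | tri≈ _ i≡j _  = contradiction i~i (Graph.adj-irrefl H i≡j)
... | inj₂ i~j    | tri> _ _ j<i  = Product.map₂ inj₂ (∈⇒lookup (∈-supportPositions (inj₂ (j<i , Graph.adj-sym H i~j))))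

¬SSP-H : ∀ A → A ∈𝒮 H → HasMultiplicityList A multiplicities → ¬ SSP A
¬SSP-H A A∈𝒮H (λs , eigenvalues) = ¬SSP-by-counting A symmetric
  (lookup λs) (increasing⇒distinct (lookup λs) increasing)
  (lookup multiplicities) (λ k → proj₁ (multiplicity k))
  (λ k → inside (proj₂ (multiplicity k))) (λ k → independent (proj₂ (multiplicity k)))
  symmetricIndex symmetricIndex-sym symmetricIndex-surjective
  (List.lookup supportPositions) covered
  where
  open _∈𝒮_ A∈𝒮H
  open DistinctEigenvalues eigenvalues
  open IsBasisOf

  covered : ∀ i j → A i j ≈ 0ℝ × i ≢ j ⊎
    ∃ λ p → List.lookup supportPositions p ≡ (i , j) ⊎ List.lookup supportPositions p ≡ (j , i)
  covered i j with (i ≟ j) ⊎-dec Adj? i j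
  ... | yes related  = inj₂ (supportPositions-complete i j related)
  -- `support` only turns A i j ≉ 0 into adjacency; its contrapositive is a double negation, removed
  -- by stability.
  ... | no unrelated = inj₁ (≈0-stable (λ a≉0 → unrelated (inj₂ (Equivalence.to (support i j i≢j) a≉0))) , i≢j)
    where
    i≢j : i ≢ j
    i≢j = unrelated ∘ inj₁

-- Elimination over ℤ[√2]

infix 5 _+√2·_

record ℤ[√2] : Set where
  constructor _+√2·_
  field
    rational   : ℤ
    irrational : ℤ

infixl 7 _*ᴷ_
infixl 6 _-ᴷ_ _+ᴷ_

0ᴷ 1ᴷ : ℤ[√2]
0ᴷ = + 0 +√2· + 0
1ᴷ = + 1 +√2· + 0

_+ᴷ_ _-ᴷ_ _*ᴷ_ : ℤ[√2] → ℤ[√2] → ℤ[√2]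
(a +√2· b) +ᴷ (c +√2· d) = (a ℤ.+ c) +√2· (b ℤ.+ d)
(a +√2· b) -ᴷ (c +√2· d) = (a ℤ.- c) +√2· (b ℤ.- d)
(a +√2· b) *ᴷ (c +√2· d) = (a ℤ.* c ℤ.+ + 2 ℤ.* (b ℤ.* d)) +√2· (a ℤ.* d ℤ.+ b ℤ.* c)

conjugate : ℤ[√2] → ℤ[√2]
conjugate (a +√2· b) = a +√2· (ℤ.- b)

norm : ℤ[√2] → ℤ
norm (a +√2· b) = a ℤ.* a ℤ.- + 2 ℤ.* (b ℤ.* b)

_≟ᴷ_ : DecidableEquality ℤ[√2]
(a +√2· b) ≟ᴷ (c +√2· d) = map′ (λ { (≡.refl , ≡.refl) → ≡.refl }) (λ { ≡.refl → ≡.refl , ≡.refl })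
  ((a ℤₚ.≟ c) ×-dec (b ℤₚ.≟ d))

⟦_⟧ᴷ : ℤ[√2] → ℝ
⟦ a +√2· b ⟧ᴷ = ι a + √2 * ι b

ι-+ : ∀ m n → ι (m ℤ.+ n) ≈ ι m + ι n
ι-+ m n = pointwise λ _ → fromℤ-+ m n

ι-* : ∀ m n → ι (m ℤ.* n) ≈ ι m * ι n
ι-* m n = pointwise λ _ → fromℤ-* m n

ι-neg : ∀ n → ι (ℤ.- n) ≈ - ι n
ι-neg n = pointwise λ _ → fromℤ-neg n

ι-- : ∀ m n → ι (m ℤ.- n) ≈ ι m - ι n
ι-- m n = ≈-trans (ι-+ m (ℤ.- n)) (+-congˡ (ι-neg n))

√2-reduce : ∀ x → √2 * √2 * x ≈ ι (+ 2) * x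
√2-reduce x = *-congʳ (≈-trans √2*√2≈2 (pointwise λ _ → ≡.refl))

⟦⟧-integer : ∀ n → ⟦ n +√2· + 0 ⟧ᴷ ≈ ι n
⟦⟧-integer n = solve 2 (λ n r → n :+ r :* con (+ 0) := n) ≈-refl (ι n) √2

exact-constant : ∀ {x} n → x ≈ ι n → x ≈ ⟦ n +√2· + 0 ⟧ᴷ
exact-constant n x≈n = ≈-trans x≈n (≈-sym (⟦⟧-integer n))

⟦⟧-+ : ∀ x y → ⟦ x +ᴷ y ⟧ᴷ ≈ ⟦ x ⟧ᴷ + ⟦ y ⟧ᴷ
⟦⟧-+ (a +√2· b) (c +√2· d) = ≈-trans (+-cong (ι-+ a c) (*-congˡ (ι-+ b d)))
  (solve 5 (λ a b c d r → (a :+ c) :+ r :* (b :+ d) := (a :+ r :* b) :+ (c :+ r :* d)) ≈-refl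
    (ι a) (ι b) (ι c) (ι d) √2)

⟦⟧-- : ∀ x y → ⟦ x -ᴷ y ⟧ᴷ ≈ ⟦ x ⟧ᴷ - ⟦ y ⟧ᴷ
⟦⟧-- (a +√2· b) (c +√2· d) = ≈-trans (+-cong (ι-- a c) (*-congˡ (ι-- b d)))
  (solve 5 (λ a b c d r → (a :- c) :+ r :* (b :- d) := (a :+ r :* b) :- (c :+ r :* d)) ≈-refl
    (ι a) (ι b) (ι c) (ι d) √2)

⟦⟧-* : ∀ x y → ⟦ x *ᴷ y ⟧ᴷ ≈ ⟦ x ⟧ᴷ * ⟦ y ⟧ᴷ
⟦⟧-* (a +√2· b) (c +√2· d) = begin
  ι (a ℤ.* c ℤ.+ + 2 ℤ.* (b ℤ.* d)) + √2 * ι (a ℤ.* d ℤ.+ b ℤ.* c)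
    ≈⟨ +-cong
         (≈-trans (ι-+ (a ℤ.* c) _) (+-cong (ι-* a c) (≈-trans (ι-* (+ 2) (b ℤ.* d)) (*-congˡ (ι-* b d)))))
         (*-congˡ (≈-trans (ι-+ (a ℤ.* d) _) (+-cong (ι-* a d) (ι-* b c)))) ⟩
  (ι a * ι c + ι (+ 2) * (ι b * ι d)) + √2 * (ι a * ι d + ι b * ι c)
    ≈⟨ +-congʳ (+-congˡ (√2-reduce (ι b * ι d))) ⟨
  (ι a * ι c + √2 * √2 * (ι b * ι d)) + √2 * (ι a * ι d + ι b * ι c)
    ≈⟨ solve 5 (λ a b c d r → (a :* c :+ r :* r :* (b :* d)) :+ r :* (a :* d :+ b :* c)
         := (a :+ r :* b) :* (c :+ r :* d)) ≈-refl (ι a) (ι b) (ι c) (ι d) √2 ⟩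
  (ι a + √2 * ι b) * (ι c + √2 * ι d) ∎

⟦⟧-norm : ∀ x → ⟦ x ⟧ᴷ * ⟦ conjugate x ⟧ᴷ ≈ ι (norm x)
⟦⟧-norm (a +√2· b) = begin
  (ι a + √2 * ι b) * (ι a + √2 * ι (ℤ.- b))
    ≈⟨ *-congˡ (+-congˡ (*-congˡ (ι-neg b))) ⟩
  (ι a + √2 * ι b) * (ι a + √2 * - ι b)
    ≈⟨ solve 3 (λ a b r → (a :+ r :* b) :* (a :+ r :* :- b) := a :* a :- r :* r :* (b :* b))
         ≈-refl (ι a) (ι b) √2 ⟩
  ι a * ι a - √2 * √2 * (ι b * ι b)
    ≈⟨ +-congˡ (-‿cong (√2-reduce (ι b * ι b))) ⟩
  ι a * ι a - ι (+ 2) * (ι b * ι b)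
    ≈⟨ +-cong (ι-* a a) (-‿cong (≈-trans (ι-* (+ 2) (b ℤ.* b)) (*-congˡ (ι-* b b)))) ⟨
  ι (a ℤ.* a) - ι (+ 2 ℤ.* (b ℤ.* b))
    ≈⟨ ι-- (a ℤ.* a) (+ 2 ℤ.* (b ℤ.* b)) ⟨
  ι (norm (a +√2· b)) ∎

ι-apart : ∀ n → n ≢ + 0 → Apart (ι n)
ι-apart n n≢0 = fromℚ-apart (n≢0 ∘ ≡.cong ℚ.↥_)

-- The product with the conjugate is the integer `norm x`, so that a test in ℤ certifies that a real
-- number is nonzero.
norm≢0⇒≉0 : ∀ x → norm x ≢ + 0 → ⟦ x ⟧ᴷ ≉ 0ℝ
norm≢0⇒≉0 x norm≢0 x≈0 = apart⇒≉0 (ι-apart (norm x) norm≢0) (begin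
  ι (norm x)                     ≈⟨ ⟦⟧-norm x ⟨
  ⟦ x ⟧ᴷ * ⟦ conjugate x ⟧ᴷ      ≈⟨ *-congʳ x≈0 ⟩
  0ℝ * ⟦ conjugate x ⟧ᴷ          ≈⟨ zeroˡ ⟦ conjugate x ⟧ᴷ ⟩
  0ℝ                             ∎)

⟦0⟧≈0 : ⟦ 0ᴷ ⟧ᴷ ≈ 0ℝ
⟦0⟧≈0 = ⟦⟧-integer (+ 0)

⟦1⟧≈1 : ⟦ 1ᴷ ⟧ᴷ ≈ 1ℝ
⟦1⟧≈1 = ⟦⟧-integer (+ 1)

infixl 7 _∙_
_∙_ : ∀ {n} → Vec ℤ[√2] n → Vector ℝ n → ℝ
r ∙ x = sum λ i → ⟦ lookup r i ⟧ᴷ * x i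

∙-replicate : ∀ n x → Vec.replicate n 0ᴷ ∙ x ≈ 0ℝ
∙-replicate n x = sum-zero λ i →
  ≈-trans (*-congʳ (≈-trans (≈-reflexive (≡.cong ⟦_⟧ᴷ (lookup-replicate i 0ᴷ))) ⟦0⟧≈0)) (zeroˡ (x i))

_≡ᵇ0 : ℤ → Bool
(+ 0) ≡ᵇ0 = true
_     ≡ᵇ0 = false

isZero : ℤ[√2] → Bool
isZero (a +√2· b) = (a ≡ᵇ0) ∧ (b ≡ᵇ0)

isZero⇒≡0 : ∀ x → isZero x ≡ true → x ≡ 0ᴷ
isZero⇒≡0 ((+ 0) +√2· (+ 0))       _  = ≡.refl
isZero⇒≡0 ((+ 0) +√2· ℤ.+[1+ _ ])  ()
isZero⇒≡0 ((+ 0) +√2· ℤ.-[1+ _ ])  ()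
isZero⇒≡0 (ℤ.+[1+ _ ] +√2· _)      ()
isZero⇒≡0 (ℤ.-[1+ _ ] +√2· _)      ()

-- Division by zero gives zero.
quotientℤ : ℤ → ℤ → ℤ
quotientℤ a (+ 0)         = + 0
quotientℤ a ℤ.+[1+ n ]    = a /ℕ suc n
quotientℤ a ℤ.-[1+ n ]    = ℤ.- (a /ℕ suc n)

-- h / p = h · conjugate p / norm p. The result is rounded when p does not divide h; `multipliers`
-- multiplies back before trusting it.
quotient : ℤ[√2] → ℤ[√2] → ℤ[√2]
quotient h p with h *ᴷ conjugate p
... | a +√2· b = quotientℤ a (norm p) +√2· quotientℤ b (norm p)

-- Keeping the quotient when p divides h slows the growth of the entries.
multipliers : ∀ p h → ∃ λ m → ∃ λ f → ⟦ m ⟧ᴷ * ⟦ h ⟧ᴷ ≈ ⟦ f ⟧ᴷ * ⟦ p ⟧ᴷ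
multipliers p h with (quotient h p *ᴷ p) ≟ᴷ h
... | yes qp≡h = 1ᴷ , quotient h p , ≈-trans (*-congʳ ⟦1⟧≈1) (≈-trans (*-identityˡ _)
        (≈-trans (≈-reflexive (≡.cong ⟦_⟧ᴷ (≡.sym qp≡h))) (⟦⟧-* (quotient h p) p)))
... | no _     = p , h , *-comm _ _

combine : ℤ[√2] → ℤ[√2] → ∀ {n} → Vec ℤ[√2] n → Vec ℤ[√2] n → Vec ℤ[√2] n
combine m f = Vec.zipWith λ a b → m *ᴷ a -ᴷ f *ᴷ b

∙-combine : ∀ m f {n} (u v : Vec ℤ[√2] n) x →
  combine m f u v ∙ x ≈ ⟦ m ⟧ᴷ * (u ∙ x) - ⟦ f ⟧ᴷ * (v ∙ x)
∙-combine m f u v x = begin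
  sum (λ i → ⟦ lookup (combine m f u v) i ⟧ᴷ * x i)
    ≈⟨ sum-cong-≋ (λ i → ≈-trans
         (*-congʳ (≈-trans (≈-reflexive (≡.cong ⟦_⟧ᴷ (lookup-zipWith _ i u v))) (eval (lookup u i) (lookup v i))))
         (solve 5 (λ m f a b x → (m :* a :- f :* b) :* x := m :* (a :* x) :- f :* (b :* x)) ≈-refl
            ⟦ m ⟧ᴷ ⟦ f ⟧ᴷ ⟦ lookup u i ⟧ᴷ ⟦ lookup v i ⟧ᴷ (x i))) ⟩
  sum (λ i → ⟦ m ⟧ᴷ * (⟦ lookup u i ⟧ᴷ * x i) - ⟦ f ⟧ᴷ * (⟦ lookup v i ⟧ᴷ * x i))
    ≈⟨ sum-- (λ i → ⟦ m ⟧ᴷ * (⟦ lookup u i ⟧ᴷ * x i)) (λ i → ⟦ f ⟧ᴷ * (⟦ lookup v i ⟧ᴷ * x i)) ⟩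
  sum (λ i → ⟦ m ⟧ᴷ * (⟦ lookup u i ⟧ᴷ * x i)) - sum (λ i → ⟦ f ⟧ᴷ * (⟦ lookup v i ⟧ᴷ * x i))
    ≈⟨ +-cong (*-distribˡ-sum ⟦ m ⟧ᴷ (λ i → ⟦ lookup u i ⟧ᴷ * x i))
         (-‿cong (*-distribˡ-sum ⟦ f ⟧ᴷ (λ i → ⟦ lookup v i ⟧ᴷ * x i))) ⟨
  ⟦ m ⟧ᴷ * (u ∙ x) - ⟦ f ⟧ᴷ * (v ∙ x) ∎
  where
  eval : ∀ a b → ⟦ m *ᴷ a -ᴷ f *ᴷ b ⟧ᴷ ≈ ⟦ m ⟧ᴷ * ⟦ a ⟧ᴷ - ⟦ f ⟧ᴷ * ⟦ b ⟧ᴷ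
  eval a b = ≈-trans (⟦⟧-- (m *ᴷ a) (f *ᴷ b)) (+-cong (⟦⟧-* m a) (-‿cong (⟦⟧-* f b)))

eliminate : ∀ {n} → Vec ℤ[√2] (suc n) → Vec ℤ[√2] (suc n) → Vec ℤ[√2] n
eliminate (p ∷ v) (h ∷ u) =
  if isZero h then u else combine (proj₁ (multipliers p h)) (proj₁ (proj₂ (multipliers p h))) u v

cancel-leading : ∀ {m h f p} → m * h ≈ f * p → ∀ x u v →
  p * x + v ≈ 0ℝ → h * x + u ≈ 0ℝ → m * u - f * v ≈ 0ℝ
cancel-leading {m} {h} {f} {p} mh≈fp x u v px+v≈0 hx+u≈0 = begin
  m * u - f * v
    ≈⟨ solve 7 (λ m f h p x u v → m :* u :- f :* v :=
         m :* (h :* x :+ u) :- f :* (p :* x :+ v) :- (m :* h :- f :* p) :* x) ≈-refl m f h p x u v ⟩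
  m * (h * x + u) - f * (p * x + v) - (m * h - f * p) * x
    ≈⟨ +-cong (+-cong (*-congˡ hx+u≈0) (-‿cong (*-congˡ px+v≈0))) (-‿cong (*-congʳ (x≈y⇒x-y≈0 mh≈fp))) ⟩
  m * 0ℝ - f * 0ℝ - 0ℝ * x
    ≈⟨ solve 3 (λ m f x → m :* con (+ 0) :- f :* con (+ 0) :- con (+ 0) :* x := con (+ 0))
         ≈-refl m f x ⟩
  0ℝ ∎

eliminate-sound : ∀ {n} (v u : Vec ℤ[√2] (suc n)) x →
  v ∙ x ≈ 0ℝ → u ∙ x ≈ 0ℝ → eliminate v u ∙ (x ∘ suc) ≈ 0ℝ
eliminate-sound (p ∷ v) (h ∷ u) x vx≈0 ux≈0 = cases (isZero h) ≡.refl
  where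
  m f : ℤ[√2]
  m = proj₁ (multipliers p h)
  f = proj₁ (proj₂ (multipliers p h))

  cases : ∀ b → isZero h ≡ b → (if b then u else combine m f u v) ∙ (x ∘ suc) ≈ 0ℝ
  cases true  eq = begin
    u ∙ (x ∘ suc)                    ≈⟨ +-identityˡ (u ∙ (x ∘ suc)) ⟨
    0ℝ + u ∙ (x ∘ suc)               ≈⟨ +-congʳ (≈-trans (*-congʳ h≈0) (zeroˡ (x zero))) ⟨
    ⟦ h ⟧ᴷ * x zero + u ∙ (x ∘ suc)  ≈⟨ ux≈0 ⟩
    0ℝ                               ∎
    where
    h≈0 : ⟦ h ⟧ᴷ ≈ 0ℝ
    h≈0 = ≈-trans (≈-reflexive (≡.cong ⟦_⟧ᴷ (isZero⇒≡0 h eq))) ⟦0⟧≈0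
  cases false _  = ≈-trans (∙-combine m f u v (x ∘ suc))
    (cancel-leading (proj₂ (proj₂ (multipliers p h))) (x zero) (u ∙ (x ∘ suc)) (v ∙ (x ∘ suc)) vx≈0 ux≈0)

∣norm∣ : ℤ[√2] → ℕ
∣norm∣ x = ℤ.∣ norm x ∣

-- Leading coefficients of small nonzero norm are preferred, since they divide others more often.
-- The test for norm 0 makes any row with nonzero leading coefficient win against the zero row from
-- which `pivot` starts.
better : ∀ {n} → Vec ℤ[√2] (suc n) → Vec ℤ[√2] (suc n) → Vec ℤ[√2] (suc n)
better (h ∷ u) (k ∷ v) =
  if isZero h then k ∷ v
  else if (∣norm∣ k ℕ.≡ᵇ 0) ∨ (∣norm∣ h ℕ.≤ᵇ ∣norm∣ k) then h ∷ u else k ∷ v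

-- The default zero row satisfies every homogeneous system, so it is a harmless start of the fold.
-- If it survives, its leading norm is 0 and `trivialKernel` answers `false`.
pivot : ∀ {n} → List (Vec ℤ[√2] (suc n)) → Vec ℤ[√2] (suc n)
pivot = List.foldr better (Vec.replicate _ 0ᴷ)

pivot-preserves : ∀ {n} (P : Vec ℤ[√2] (suc n) → Set) → P (Vec.replicate _ 0ᴷ) →
  ∀ {rows} → All P rows → P (pivot rows)
pivot-preserves P p0 []                            = p0
pivot-preserves P p0 {(h ∷ u) ∷ rows} (pr ∷ prs)
  with pivot rows | pivot-preserves P p0 prs
... | k ∷ v | pk with isZero h
...   | true  = pk
...   | false with (∣norm∣ k ℕ.≡ᵇ 0) ∨ (∣norm∣ h ℕ.≤ᵇ ∣norm∣ k)
...     | true  = pr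
...     | false = pk

-- The answer `true` is a certificate that `≡.refl` obtains by evaluation. The pivot row stays in
-- the list and is eliminated by itself to a zero row.
trivialKernel : ∀ {n} → List (Vec ℤ[√2] n) → Bool
trivialKernel {zero}  rows = true
trivialKernel {suc n} rows =
  not (norm (head (pivot rows)) ≡ᵇ0) ∧ trivialKernel (List.map (eliminate (pivot rows)) rows)

leading≈0 : ∀ {n} (r : Vec ℤ[√2] (suc n)) x → not (norm (head r) ≡ᵇ0) ≡ true →
  r ∙ x ≈ 0ℝ → x ∘ suc ≋ 0ᵛ → x zero ≈ 0ℝ
leading≈0 (p ∷ v) x p-nonzero rx≈0 tail≈0 = *-cancel-≉0 (norm≢0⇒≉0 p norm≢0) (begin
  ⟦ p ⟧ᴷ * x zero                      ≈⟨ +-identityʳ (⟦ p ⟧ᴷ * x zero) ⟨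
  ⟦ p ⟧ᴷ * x zero + 0ℝ
    ≈⟨ +-congˡ (sum-zero λ i → ≈-trans (*-congˡ (tail≈0 i)) (zeroʳ ⟦ lookup v i ⟧ᴷ)) ⟨
  ⟦ p ⟧ᴷ * x zero + v ∙ (x ∘ suc)      ≈⟨ rx≈0 ⟩
  0ℝ                                   ∎)
  where
  norm≢0 : norm p ≢ + 0
  norm≢0 eq with ≡.subst (λ z → not (z ≡ᵇ0) ≡ true) eq p-nonzero
  ... | ()

trivialKernel-sound : ∀ {n} (rows : List (Vec ℤ[√2] n)) → trivialKernel rows ≡ true →
  ∀ x → All (λ r → r ∙ x ≈ 0ℝ) rows → x ≋ 0ᵛ
trivialKernel-sound {zero}  rows _  x rows≈0 ()
trivialKernel-sound {suc n} rows ok x rows≈0 = λ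
  { zero    → leading≈0 (pivot rows) x (∧-conicalˡ _ _ ok) pivot≈0 tail≈0
  ; (suc i) → tail≈0 i
  }
  where
  pivot≈0 : pivot rows ∙ x ≈ 0ℝ
  pivot≈0 = pivot-preserves (λ r → r ∙ x ≈ 0ℝ) (∙-replicate _ x) rows≈0

  tail≈0 : x ∘ suc ≋ 0ᵛ
  tail≈0 = trivialKernel-sound (List.map (eliminate (pivot rows)) rows) (∧-conicalʳ _ _ ok) (x ∘ suc)
    (Allₚ.map⁺ (All.map (λ {u} → eliminate-sound (pivot rows) u x pivot≈0) rows≈0))

-- The SMP as a homogeneous linear system over ℤ[√2]

accumulate : ∀ {n} → ℤ[√2] → Vec ℤ[√2] n → Vec ℤ[√2] n → Vec ℤ[√2] n
accumulate c v acc = if isZero c then acc else Vec.zipWith (λ a b → c *ᴷ a +ᴷ b) v acc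

combination : ∀ {m n} → (Fin m → ℤ[√2]) → (Fin m → Vec ℤ[√2] n) → Vec ℤ[√2] n
combination {zero}  c v = Vec.replicate _ 0ᴷ
combination {suc m} c v = accumulate (c zero) (v zero) (combination (c ∘ suc) (v ∘ suc))

sumᴷ : ∀ {n} → (Fin n → ℤ[√2]) → ℤ[√2]
sumᴷ {zero}  t = 0ᴷ
sumᴷ {suc n} t = t zero +ᴷ sumᴷ (t ∘ suc)

_·ᴷ_ : ∀ {n} → (Fin n → Fin n → ℤ[√2]) → (Fin n → Fin n → ℤ[√2]) → (Fin n → Fin n → ℤ[√2])
(P ·ᴷ Q) i j = sumᴷ λ k → P i k *ᴷ Q k j

Iᴷ : ∀ {n} → Fin n → Fin n → ℤ[√2]
Iᴷ i j = if does (i ≟ j) then 1ᴷ else 0ᴷ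

Match : ∀ {n} → Fin n × Fin n → Fin n → Fin n → Set
Match (k , l) i j = (k ≡ i × l ≡ j) ⊎ (k ≡ j × l ≡ i)

match? : ∀ {n} (p : Fin n × Fin n) i j → Dec (Match p i j)
match? (k , l) i j = ((k ≟ i) ×-dec (l ≟ j)) ⊎-dec ((k ≟ j) ×-dec (l ≟ i))

-- The entry (i , j) of a symmetric matrix supported on ps, as a linear
-- form in its entries at ps.
symbolic : ∀ {n} (ps : List (Fin n × Fin n)) → Fin n → Fin n → Vec ℤ[√2] (List.length ps)
symbolic []       i j = []
symbolic (p ∷ ps) i j =
  if does (match? p i j) then 1ᴷ ∷ Vec.replicate _ 0ᴷ else 0ᴷ ∷ symbolic ps i j

module _ {n} (Aᴷ : Fin n → Fin n → ℤ[√2]) (ps : List (Fin n × Fin n)) where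

  commutatorRow : Fin n × Fin n → Vec ℤ[√2] (List.length ps)
  commutatorRow (i , j) = combine 1ᴷ 1ᴷ
    (combination (Aᴷ i) (λ k → symbolic ps k j)) (combination (λ k → Aᴷ k j) (symbolic ps i))

  traceRow : Vec ℤ[√2] (List.length ps)
  traceRow = combination (λ _ → 1ᴷ) λ i → combination ((Aᴷ ·ᴷ Aᴷ) i) λ k → symbolic ps k i

  SMP-rows : List (Vec ℤ[√2] (List.length ps))
  SMP-rows = traceRow ∷ List.map commutatorRow
    -- For symmetric A and X the commutator is skew-symmetric, so its entries above the diagonal
    -- carry all the conditions.
    (List.filter (λ (i , j) → i Finₚ.<? j) (List.cartesianProduct (List.allFin n) (List.allFin n)))

I≈Iᴷ : ∀ {n} (i j : Fin n) → I i j ≈ ⟦ Iᴷ i j ⟧ᴷ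
I≈Iᴷ i j with i ≟ j
... | yes _ = ≈-sym ⟦1⟧≈1
... | no  _ = ≈-sym ⟦0⟧≈0

I-symmetric : ∀ {n} → IsSymmetric {n} I
I-symmetric i j with i ≟ j | j ≟ i
... | yes _   | yes _   = ≈-refl
... | no  _   | no  _   = ≈-refl
... | yes i≡j | no j≢i  = contradiction (≡.sym i≡j) j≢i
... | no i≢j  | yes j≡i = contradiction (≡.sym j≡i) i≢j

⟦⟧-sum : ∀ {n} (t : Fin n → ℤ[√2]) → ⟦ sumᴷ t ⟧ᴷ ≈ sum (λ k → ⟦ t k ⟧ᴷ)
⟦⟧-sum {zero}  t = ⟦0⟧≈0
⟦⟧-sum {suc n} t = ≈-trans (⟦⟧-+ (t zero) (sumᴷ (t ∘ suc))) (+-congˡ (⟦⟧-sum (t ∘ suc)))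

⟦⟧-· : ∀ {n} {P Q : Matrix n} {Pᴷ Qᴷ} → (∀ i j → P i j ≈ ⟦ Pᴷ i j ⟧ᴷ) → (∀ i j → Q i j ≈ ⟦ Qᴷ i j ⟧ᴷ) →
  ∀ i j → (P · Q) i j ≈ ⟦ (Pᴷ ·ᴷ Qᴷ) i j ⟧ᴷ
⟦⟧-· {P = P} {Q} {Pᴷ} {Qᴷ} P≈ Q≈ i j = begin
  sum (λ k → P i k * Q k j)                    ≈⟨ sum-cong-≋ (λ k → *-cong (P≈ i k) (Q≈ k j)) ⟩
  sum (λ k → ⟦ Pᴷ i k ⟧ᴷ * ⟦ Qᴷ k j ⟧ᴷ)        ≈⟨ sum-cong-≋ (λ k → ⟦⟧-* (Pᴷ i k) (Qᴷ k j)) ⟨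
  sum (λ k → ⟦ Pᴷ i k *ᴷ Qᴷ k j ⟧ᴷ)            ≈⟨ ⟦⟧-sum (λ k → Pᴷ i k *ᴷ Qᴷ k j) ⟨
  ⟦ (Pᴷ ·ᴷ Qᴷ) i j ⟧ᴷ                          ∎

·-identityʳ : ∀ {n} (A : Matrix n) → A · I ≋ᴹ A
·-identityʳ A i j = ≈-trans
  (sum-cong-≋ λ k → ≈-trans (*-comm (A i k) (I k j)) (*-congʳ {A i k} (I-symmetric k j)))
  (sum-I (A i) j)

I-diagonal : ∀ {n} (i : Fin n) → 1ℝ ≈ I i i
I-diagonal i with i ≟ i
... | yes _  = ≈-refl
... | no i≢i = contradiction ≡.refl i≢i

∙ᵛ-· : ∀ {n} (P Q : Matrix n) v → (P · Q) ∙ᵛ v ≋ P ∙ᵛ (Q ∙ᵛ v)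
∙ᵛ-· P Q v i = begin
  sum (λ j → sum (λ k → P i k * Q k j) * v j)
    ≈⟨ sum-cong-≋ (λ j → *-distribʳ-sum (v j) (λ k → P i k * Q k j)) ⟩
  sum (λ j → sum (λ k → P i k * Q k j * v j))    ≈⟨ ∑-comm (λ j k → P i k * Q k j * v j) ⟩
  sum (λ k → sum (λ j → P i k * Q k j * v j))
    ≈⟨ sum-cong-≋ (λ k → sum-cong-≋ λ j → *-assoc (P i k) (Q k j) (v j)) ⟩
  sum (λ k → sum (λ j → P i k * (Q k j * v j)))
    ≈⟨ sum-cong-≋ (λ k → *-distribˡ-sum (P i k) (λ j → Q k j * v j)) ⟨
  sum (λ k → P i k * sum (λ j → Q k j * v j))    ∎

1* : ∀ x → ⟦ 1ᴷ ⟧ᴷ * x ≈ x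
1* x = ≈-trans (*-congʳ ⟦1⟧≈1) (*-identityˡ x)

∙-tabulate : ∀ {n} (c : Fin n → ℤ[√2]) x → Vec.tabulate c ∙ x ≈ sum (λ i → ⟦ c i ⟧ᴷ * x i)
∙-tabulate c x = sum-cong-≋ λ i → *-congʳ {x i} (≈-reflexive (≡.cong ⟦_⟧ᴷ (lookup∘tabulate c i)))

∙-accumulate : ∀ c {n} (v acc : Vec ℤ[√2] n) x → accumulate c v acc ∙ x ≈ ⟦ c ⟧ᴷ * (v ∙ x) + acc ∙ x
∙-accumulate c v acc x = cases (isZero c) ≡.refl
  where
  cases : ∀ b → isZero c ≡ b →
    (if b then acc else Vec.zipWith (λ a b → c *ᴷ a +ᴷ b) v acc) ∙ x ≈ ⟦ c ⟧ᴷ * (v ∙ x) + acc ∙ x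
  cases true  eq = begin
    acc ∙ x                       ≈⟨ +-identityˡ (acc ∙ x) ⟨
    0ℝ + acc ∙ x                  ≈⟨ +-congʳ (≈-trans (*-congʳ c≈0) (zeroˡ (v ∙ x))) ⟨
    ⟦ c ⟧ᴷ * (v ∙ x) + acc ∙ x    ∎
    where
    c≈0 : ⟦ c ⟧ᴷ ≈ 0ℝ
    c≈0 = ≈-trans (≈-reflexive (≡.cong ⟦_⟧ᴷ (isZero⇒≡0 c eq))) ⟦0⟧≈0
  cases false _  = begin
    Vec.zipWith (λ a b → c *ᴷ a +ᴷ b) v acc ∙ x
      ≈⟨ sum-cong-≋ (λ i → ≈-trans (*-congʳ {x i} (entry i))
           (solve 4 (λ c a b x → (c :* a :+ b) :* x := c :* (a :* x) :+ con (+ 1) :* (b :* x)) ≈-refl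
             ⟦ c ⟧ᴷ ⟦ lookup v i ⟧ᴷ ⟦ lookup acc i ⟧ᴷ (x i))) ⟩
    sum (λ i → ⟦ c ⟧ᴷ * (⟦ lookup v i ⟧ᴷ * x i) + 1ℝ * (⟦ lookup acc i ⟧ᴷ * x i))
      ≈⟨ sum-linear ⟦ c ⟧ᴷ 1ℝ (λ i → ⟦ lookup v i ⟧ᴷ * x i) (λ i → ⟦ lookup acc i ⟧ᴷ * x i) ⟩
    ⟦ c ⟧ᴷ * (v ∙ x) + 1ℝ * (acc ∙ x)
      ≈⟨ +-congˡ (*-identityˡ (acc ∙ x)) ⟩
    ⟦ c ⟧ᴷ * (v ∙ x) + acc ∙ x ∎
    where
    entry : ∀ i → ⟦ lookup (Vec.zipWith (λ a b → c *ᴷ a +ᴷ b) v acc) i ⟧ᴷ ≈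
      ⟦ c ⟧ᴷ * ⟦ lookup v i ⟧ᴷ + ⟦ lookup acc i ⟧ᴷ
    entry i = ≈-trans (≈-reflexive (≡.cong ⟦_⟧ᴷ (lookup-zipWith _ i v acc)))
      (≈-trans (⟦⟧-+ (c *ᴷ lookup v i) (lookup acc i)) (+-congʳ (⟦⟧-* c (lookup v i))))

∙-combination : ∀ {m n} c (v : Fin m → Vec ℤ[√2] n) x →
  combination c v ∙ x ≈ sum (λ k → ⟦ c k ⟧ᴷ * (v k ∙ x))
∙-combination {zero}  {n} c v x = ∙-replicate n x
∙-combination {suc m}     c v x = ≈-trans
  (∙-accumulate (c zero) (v zero) (combination (c ∘ suc) (v ∘ suc)) x)
  (+-congˡ (∙-combination (c ∘ suc) (v ∘ suc) x))

positionValues : ∀ {n} → Matrix n → (ps : List (Fin n × Fin n)) → Vector ℝ (List.length ps)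
positionValues X ps p = X (proj₁ (List.lookup ps p)) (proj₂ (List.lookup ps p))

∙-symbolic : ∀ {n} (X : Matrix n) → IsSymmetric X → ∀ ps {i j} →
  X i j ≈ 0ℝ ⊎ (i , j) ∈ ps ⊎ (j , i) ∈ ps → symbolic ps i j ∙ positionValues X ps ≈ X i j
∙-symbolic X X-sym []             (inj₁ x≈0)       = ≈-sym x≈0
∙-symbolic X X-sym []             (inj₂ (inj₁ ()))
∙-symbolic X X-sym []             (inj₂ (inj₂ ()))
∙-symbolic X X-sym ((k , l) ∷ ps) {i} {j} known = cases (match? (k , l) i j)
  where
  same : Match (k , l) i j → X k l ≈ X i j
  same (inj₁ (≡.refl , ≡.refl)) = ≈-refl
  same (inj₂ (≡.refl , ≡.refl)) = X-sym k l

  later : ¬ Match (k , l) i j → X i j ≈ 0ℝ ⊎ (i , j) ∈ ((k , l) ∷ ps) ⊎ (j , i) ∈ ((k , l) ∷ ps) →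
    X i j ≈ 0ℝ ⊎ (i , j) ∈ ps ⊎ (j , i) ∈ ps
  later mismatch (inj₁ x≈0)                   = inj₁ x≈0
  later mismatch (inj₂ (inj₁ (here ≡.refl)))  = contradiction (inj₁ (≡.refl , ≡.refl)) mismatch
  later mismatch (inj₂ (inj₁ (there m)))      = inj₂ (inj₁ m)
  later mismatch (inj₂ (inj₂ (here ≡.refl)))  = contradiction (inj₂ (≡.refl , ≡.refl)) mismatch
  later mismatch (inj₂ (inj₂ (there m)))      = inj₂ (inj₂ m)

  cases : (m : Dec (Match (k , l) i j)) →
    (if does m then 1ᴷ ∷ Vec.replicate _ 0ᴷ else 0ᴷ ∷ symbolic ps i j) ∙ positionValues X ((k , l) ∷ ps) ≈ X i j
  cases (yes match) = begin
    ⟦ 1ᴷ ⟧ᴷ * X k l + Vec.replicate _ 0ᴷ ∙ positionValues X ps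
      ≈⟨ +-cong (*-congʳ ⟦1⟧≈1) (∙-replicate _ (positionValues X ps)) ⟩
    1ℝ * X k l + 0ℝ  ≈⟨ +-identityʳ (1ℝ * X k l) ⟩
    1ℝ * X k l       ≈⟨ *-identityˡ (X k l) ⟩
    X k l            ≈⟨ same match ⟩
    X i j            ∎
  cases (no mismatch) = begin
    ⟦ 0ᴷ ⟧ᴷ * X k l + symbolic ps i j ∙ positionValues X ps
      ≈⟨ +-cong (≈-trans (*-congʳ ⟦0⟧≈0) (zeroˡ (X k l))) (∙-symbolic X X-sym ps (later mismatch known)) ⟩
    0ℝ + X i j  ≈⟨ +-identityˡ (X i j) ⟩
    X i j       ∎

-- The free entries x of X satisfy all rows, hence vanish, and `eval` recovers every entry of X from
-- x. A size of at least 3 puts the exponent 2 in the range of the trace conditions.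
SMP-by-elimination : ∀ {n} (A : Matrix (suc (suc (suc n)))) Aᴷ → (∀ i j → A i j ≈ ⟦ Aᴷ i j ⟧ᴷ) →
  ∀ ps → (∀ i j → i ≡ j ⊎ A i j ≉ 0ℝ ⊎ (i , j) ∈ ps ⊎ (j , i) ∈ ps) →
  trivialKernel (SMP-rows Aᴷ ps) ≡ true → SMP A
SMP-by-elimination A Aᴷ A≈Aᴷ ps complete ok X X-sym A⊙X≈0 I⊙X≈0 commutes traces i j =
  ≈-trans (≈-sym (eval i j)) (sum-zero λ p →
    ≈-trans (*-congˡ {⟦ lookup (symbolic ps i j) p ⟧ᴷ} (x≈0 p)) (zeroʳ ⟦ lookup (symbolic ps i j) p ⟧ᴷ))
  where
  x : Vector ℝ (List.length ps)
  x = positionValues X ps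

  known : ∀ i j → i ≡ j ⊎ A i j ≉ 0ℝ ⊎ (i , j) ∈ ps ⊎ (j , i) ∈ ps →
    X i j ≈ 0ℝ ⊎ (i , j) ∈ ps ⊎ (j , i) ∈ ps
  known i j (inj₁ ≡.refl)     = inj₁ (≈-trans (≈-sym (*-identityˡ (X i i)))
    (≈-trans (*-congʳ (I-diagonal i)) (I⊙X≈0 i i)))
  known i j (inj₂ (inj₁ a≉0)) = inj₁ (*-cancel-≉0 a≉0 (A⊙X≈0 i j))
  known i j (inj₂ (inj₂ free)) = inj₂ free

  eval : ∀ i j → symbolic ps i j ∙ x ≈ X i j
  eval i j = ∙-symbolic X X-sym ps (known i j (complete i j))

  commutatorRow≈0 : ∀ p → commutatorRow Aᴷ ps p ∙ x ≈ 0ℝ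
  commutatorRow≈0 (i , j) = begin
    commutatorRow Aᴷ ps (i , j) ∙ x
      ≈⟨ ∙-combine 1ᴷ 1ᴷ left right x ⟩
    ⟦ 1ᴷ ⟧ᴷ * (left ∙ x) - ⟦ 1ᴷ ⟧ᴷ * (right ∙ x)
      ≈⟨ +-cong (1* (left ∙ x)) (-‿cong (1* (right ∙ x))) ⟩
    (left ∙ x) - (right ∙ x)
      ≈⟨ +-cong (∙-combination (Aᴷ i) (λ k → symbolic ps k j) x)
           (-‿cong (∙-combination (λ k → Aᴷ k j) (symbolic ps i) x)) ⟩
    sum (λ k → ⟦ Aᴷ i k ⟧ᴷ * (symbolic ps k j ∙ x)) - sum (λ k → ⟦ Aᴷ k j ⟧ᴷ * (symbolic ps i k ∙ x))
      ≈⟨ +-cong (sum-cong-≋ λ k → *-cong (A≈Aᴷ i k) (≈-sym (eval k j)))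
           (-‿cong (sum-cong-≋ λ k → ≈-trans (*-comm (X i k) (A k j)) (*-cong (A≈Aᴷ k j) (≈-sym (eval i k))))) ⟨
    ⟦ A , X ⟧ i j
      ≈⟨ commutes i j ⟩
    0ℝ ∎
    where
    left right : Vec ℤ[√2] (List.length ps)
    left  = combination (Aᴷ i) (λ k → symbolic ps k j)
    right = combination (λ k → Aᴷ k j) (symbolic ps i)

  A² : ∀ i j → (A ^ 2) i j ≈ ⟦ (Aᴷ ·ᴷ Aᴷ) i j ⟧ᴷ
  A² = ⟦⟧-· {P = A} {A · I} {Aᴷ} {Aᴷ} A≈Aᴷ λ i j → ≈-trans (·-identityʳ A i j) (A≈Aᴷ i j)

  traceTerm : ∀ i → ⟦ 1ᴷ ⟧ᴷ * (combination ((Aᴷ ·ᴷ Aᴷ) i) (λ k → symbolic ps k i) ∙ x) ≈ ((A ^ 2) · X) i i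
  traceTerm i = begin
    ⟦ 1ᴷ ⟧ᴷ * (combination ((Aᴷ ·ᴷ Aᴷ) i) (λ k → symbolic ps k i) ∙ x)
      ≈⟨ 1* (combination ((Aᴷ ·ᴷ Aᴷ) i) (λ k → symbolic ps k i) ∙ x) ⟩
    combination ((Aᴷ ·ᴷ Aᴷ) i) (λ k → symbolic ps k i) ∙ x
      ≈⟨ ∙-combination ((Aᴷ ·ᴷ Aᴷ) i) (λ k → symbolic ps k i) x ⟩
    sum (λ k → ⟦ (Aᴷ ·ᴷ Aᴷ) i k ⟧ᴷ * (symbolic ps k i ∙ x))
      ≈⟨ sum-cong-≋ (λ k → *-cong (A² i k) (≈-sym (eval k i))) ⟨
    ((A ^ 2) · X) i i ∎

  traceRow≈0 : traceRow Aᴷ ps ∙ x ≈ 0ℝ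
  traceRow≈0 = begin
    traceRow Aᴷ ps ∙ x
      ≈⟨ ∙-combination (λ _ → 1ᴷ) (λ i → combination ((Aᴷ ·ᴷ Aᴷ) i) λ k → symbolic ps k i) x ⟩
    sum (λ i → ⟦ 1ᴷ ⟧ᴷ * (combination ((Aᴷ ·ᴷ Aᴷ) i) (λ k → symbolic ps k i) ∙ x))
      ≈⟨ sum-cong-≋ traceTerm ⟩
    tr ((A ^ 2) · X)
      ≈⟨ traces 2 (ℕ.s≤s (ℕ.s≤s ℕ.z≤n)) (ℕ.s≤s (ℕ.s≤s (ℕ.s≤s ℕ.z≤n))) ⟩
    0ℝ ∎

  x≈0 : x ≋ 0ᵛ
  x≈0 = trivialKernel-sound (SMP-rows Aᴷ ps) ok x
    (traceRow≈0 ∷ Allₚ.map⁺ (All.universal commutatorRow≈0 _))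

-- Eigenspaces of matrices over ℤ[√2]

∙ᵛ-- : ∀ {n} (A : Matrix n) v w → A ∙ᵛ (λ i → v i - w i) ≋ λ i → (A ∙ᵛ v) i - (A ∙ᵛ w) i
∙ᵛ-- A v w i = ≈-trans
  (sum-cong-≋ λ k → solve 3 (λ a v w → a :* (v :- w) := a :* v :- a :* w) ≈-refl (A i k) (v k) (w k))
  (sum-- (λ k → A i k * v k) (λ k → A i k * w k))

eigenRows : ∀ {n d} → (Fin n → Fin n → ℤ[√2]) → ℤ[√2] → (Fin d → Fin n) → List (Vec ℤ[√2] n)
eigenRows Aᴷ μ f = List.tabulate (λ i → Vec.tabulate λ j → Aᴷ i j -ᴷ μ *ᴷ Iᴷ i j)
  List.++ List.tabulate (λ l → Vec.tabulate (Iᴷ (f l)))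

-- The vectors V k, with V k (f l) = D δₖₗ, are a basis as soon as an
-- eigenvector vanishing at all f l is zero; κ is 1 / D.
module _ {n d} (A : Matrix n) (Aᴷ : Fin n → Fin n → ℤ[√2]) (A≈Aᴷ : ∀ i j → A i j ≈ ⟦ Aᴷ i j ⟧ᴷ)
  {m} (μ : ℤ[√2]) (m≈μ : m ≈ ⟦ μ ⟧ᴷ) (D : ℤ) (κ : ℝ) (κD≈1 : κ * ι D ≈ 1ℝ)
  (V : Fin d → Fin n → ℤ[√2]) (f : Fin d → Fin n)
  (eigen : ∀ k i → sumᴷ (λ j → Aᴷ i j *ᴷ V k j) ≡ μ *ᴷ V k i)
  (coordinates : ∀ k l → V k (f l) ≡ (D +√2· + 0) *ᴷ Iᴷ l k)
  (kernel : trivialKernel (eigenRows Aᴷ μ f) ≡ true)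
  where

  private
    b : Fin d → Vector ℝ n
    b k i = ⟦ V k i ⟧ᴷ

    b-eigen : ∀ k → Eigenspace A m (b k)
    b-eigen k i = begin
      sum (λ j → A i j * b k j)                  ≈⟨ sum-cong-≋ (λ j → *-congʳ {b k j} (A≈Aᴷ i j)) ⟩
      sum (λ j → ⟦ Aᴷ i j ⟧ᴷ * b k j)            ≈⟨ sum-cong-≋ (λ j → ⟦⟧-* (Aᴷ i j) (V k j)) ⟨
      sum (λ j → ⟦ Aᴷ i j *ᴷ V k j ⟧ᴷ)           ≈⟨ ⟦⟧-sum (λ j → Aᴷ i j *ᴷ V k j) ⟨
      ⟦ sumᴷ (λ j → Aᴷ i j *ᴷ V k j) ⟧ᴷ          ≈⟨ ≈-reflexive (≡.cong ⟦_⟧ᴷ (eigen k i)) ⟩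
      ⟦ μ *ᴷ V k i ⟧ᴷ                            ≈⟨ ⟦⟧-* μ (V k i) ⟩
      ⟦ μ ⟧ᴷ * b k i                             ≈⟨ *-congʳ m≈μ ⟨
      m * b k i                                  ∎

    b-coordinate : ∀ k l → b k (f l) ≈ ι D * I l k
    b-coordinate k l = begin
      ⟦ V k (f l) ⟧ᴷ                     ≈⟨ ≈-reflexive (≡.cong ⟦_⟧ᴷ (coordinates k l)) ⟩
      ⟦ (D +√2· + 0) *ᴷ Iᴷ l k ⟧ᴷ        ≈⟨ ⟦⟧-* (D +√2· + 0) (Iᴷ l k) ⟩
      ⟦ D +√2· + 0 ⟧ᴷ * ⟦ Iᴷ l k ⟧ᴷ      ≈⟨ *-cong (⟦⟧-integer D) (≈-sym (I≈Iᴷ l k)) ⟩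
      ι D * I l k                        ∎

    linComb-coordinate : ∀ c l → linComb c b (f l) ≈ c l * ι D
    linComb-coordinate c l = begin
      sum (λ k → c k * b k (f l))
        ≈⟨ sum-cong-≋ (λ k → ≈-trans (*-congˡ {c k} (b-coordinate k l))
             (solve 3 (λ c d i → c :* (d :* i) := i :* (c :* d)) ≈-refl (c k) (ι D) (I l k))) ⟩
      sum (λ k → I l k * (c k * ι D))  ≈⟨ sum-I (λ k → c k * ι D) l ⟩
      c l * ι D                        ∎

    b-independent : LinearlyIndependent b
    b-independent c cb≈0 l = begin
      c l                       ≈⟨ *-identityʳ (c l) ⟨
      c l * 1ℝ                  ≈⟨ *-congˡ κD≈1 ⟨
      c l * (κ * ι D)
        ≈⟨ solve 3 (λ c k d → c :* (k :* d) := k :* (c :* d)) ≈-refl (c l) κ (ι D) ⟩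
      κ * (c l * ι D)           ≈⟨ *-congˡ (linComb-coordinate c l) ⟨
      κ * linComb c b (f l)     ≈⟨ *-congˡ (cb≈0 (f l)) ⟩
      κ * 0ℝ                    ≈⟨ zeroʳ κ ⟩
      0ℝ                        ∎

    module _ (v : Vector ℝ n) (Av : Eigenspace A m v) where

      -- The coefficients are read off v at the positions f l and divided by D, so that w is an
      -- eigenvector that vanishes at all of them.
      c : Vector ℝ d
      c k = κ * v (f k)

      w : Vector ℝ n
      w i = v i - linComb c b i

      Aw : Eigenspace A m w
      Aw i = begin
        (A ∙ᵛ w) i                            ≈⟨ ∙ᵛ-- A v (linComb c b) i ⟩
        (A ∙ᵛ v) i - (A ∙ᵛ linComb c b) i
          ≈⟨ +-cong (Av i) (-‿cong (eigenspace-linComb A c b-eigen i)) ⟩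
        m * v i - m * linComb c b i
          ≈⟨ solve 3 (λ m v u → m :* v :- m :* u := m :* (v :- u)) ≈-refl m (v i) (linComb c b i) ⟩
        m * w i                               ∎

      eigenRow≈0 : ∀ i → Vec.tabulate (λ j → Aᴷ i j -ᴷ μ *ᴷ Iᴷ i j) ∙ w ≈ 0ℝ
      eigenRow≈0 i = begin
        Vec.tabulate (λ j → Aᴷ i j -ᴷ μ *ᴷ Iᴷ i j) ∙ w
          ≈⟨ ∙-tabulate (λ j → Aᴷ i j -ᴷ μ *ᴷ Iᴷ i j) w ⟩
        sum (λ j → ⟦ Aᴷ i j -ᴷ μ *ᴷ Iᴷ i j ⟧ᴷ * w j)
          ≈⟨ sum-cong-≋ (λ j → ≈-trans (*-congʳ {w j} (entry j))
               (solve 4 (λ a m i w → (a :- m :* i) :* w := a :* w :- m :* (i :* w))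
                    ≈-refl (A i j) m (I i j) (w j))) ⟩
        sum (λ j → A i j * w j - m * (I i j * w j))
          ≈⟨ sum-- (λ j → A i j * w j) (λ j → m * (I i j * w j)) ⟩
        (A ∙ᵛ w) i - sum (λ j → m * (I i j * w j))
          ≈⟨ +-cong (Aw i)
               (-‿cong (≈-trans (≈-sym (*-distribˡ-sum m (λ j → I i j * w j))) (*-congˡ (sum-I w i)))) ⟩
        m * w i - m * w i
          ≈⟨ -‿inverseʳ (m * w i) ⟩
        0ℝ ∎
        where
        entry : ∀ j → ⟦ Aᴷ i j -ᴷ μ *ᴷ Iᴷ i j ⟧ᴷ ≈ A i j - m * I i j
        entry j = ≈-trans (⟦⟧-- (Aᴷ i j) (μ *ᴷ Iᴷ i j)) (+-cong (≈-sym (A≈Aᴷ i j))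
          (-‿cong (≈-trans (⟦⟧-* μ (Iᴷ i j)) (*-cong (≈-sym m≈μ) (≈-sym (I≈Iᴷ i j))))))

      coordinateRow≈0 : ∀ l → Vec.tabulate (Iᴷ (f l)) ∙ w ≈ 0ℝ
      coordinateRow≈0 l = begin
        Vec.tabulate (Iᴷ (f l)) ∙ w                 ≈⟨ ∙-tabulate (Iᴷ (f l)) w ⟩
        sum (λ j → ⟦ Iᴷ (f l) j ⟧ᴷ * w j)           ≈⟨ sum-cong-≋ (λ j → *-congʳ {w j} (I≈Iᴷ (f l) j)) ⟨
        sum (λ j → I (f l) j * w j)                 ≈⟨ sum-I w (f l) ⟩
        v (f l) - linComb c b (f l)                 ≈⟨ +-congˡ (-‿cong (linComb-coordinate c l)) ⟩
        v (f l) - κ * v (f l) * ι D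
          ≈⟨ solve 3 (λ v k d → v :- k :* v :* d := v :- (k :* d) :* v) ≈-refl (v (f l)) κ (ι D) ⟩
        v (f l) - (κ * ι D) * v (f l)               ≈⟨ +-congˡ (-‿cong (*-congʳ κD≈1)) ⟩
        v (f l) - 1ℝ * v (f l)                      ≈⟨ +-congˡ (-‿cong (*-identityˡ (v (f l)))) ⟩
        v (f l) - v (f l)                           ≈⟨ -‿inverseʳ (v (f l)) ⟩
        0ℝ                                          ∎

      v≈linComb : v ≋ linComb c b
      v≈linComb i = x-y≈0⇒x≈y (trivialKernel-sound (eigenRows Aᴷ μ f) kernel w
        (Allₚ.++⁺ (Allₚ.tabulate⁺ eigenRow≈0) (Allₚ.tabulate⁺ coordinateRow≈0)) i)

  eigenspace-dimension : HasDimension (Eigenspace A m) d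
  eigenspace-dimension = b , record
    { inside      = b-eigen
    ; independent = b-independent
    ; spanning    = λ v Av → c v Av , v≈linComb v Av
    }

dimension⇒nonzero : ∀ {n d} {P : Vector ℝ n → Set} → HasDimension P (suc d) → ∃ λ v → ¬ (v ≋ 0ᵛ) × P v
dimension⇒nonzero (b , basis) = b zero
  , (λ b₀≈0 → 1≉0 (independent (I zero) (λ i → ≈-trans (sum-I (λ k → b k i) zero) (b₀≈0 i)) zero))
  , inside zero
  where open IsBasisOf basis

-- The matrix B

-- Storing a real together with its code and their agreement lets one table yield `B`, `Bᴷ` and the
-- proof that they agree.
record Exact : Set where
  constructor exact
  field
    {value} : ℝ
    code    : ℤ[√2]
    correct : value ≈ ⟦ code ⟧ᴷ

open Exact

exact-integer : ∀ {x} n → x ≈ ι n → Exact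
exact-integer {x} n x≈n = exact {x} (n +√2· + 0) (exact-constant n x≈n)

B-table : Vec (Vec Exact 12) 12
B-table =
  (p1 ∷ m1 ∷ o  ∷ o  ∷ o  ∷ m1 ∷ r  ∷ o  ∷ o  ∷ o  ∷ o  ∷ o  ∷ []) ∷
  (m1 ∷ p1 ∷ m1 ∷ o  ∷ o  ∷ o  ∷ o  ∷ r  ∷ o  ∷ o  ∷ o  ∷ o  ∷ []) ∷
  (o  ∷ m1 ∷ p1 ∷ m1 ∷ o  ∷ o  ∷ o  ∷ o  ∷ r  ∷ o  ∷ o  ∷ o  ∷ []) ∷
  (o  ∷ o  ∷ m1 ∷ p1 ∷ m1 ∷ o  ∷ r  ∷ o  ∷ o  ∷ o  ∷ o  ∷ o  ∷ []) ∷
  (o  ∷ o  ∷ o  ∷ m1 ∷ p1 ∷ m1 ∷ o  ∷ r  ∷ o  ∷ o  ∷ o  ∷ o  ∷ []) ∷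
  (m1 ∷ o  ∷ o  ∷ o  ∷ m1 ∷ p1 ∷ o  ∷ o  ∷ r  ∷ o  ∷ o  ∷ o  ∷ []) ∷
  (r  ∷ o  ∷ o  ∷ r  ∷ o  ∷ o  ∷ m2 ∷ o  ∷ o  ∷ p2 ∷ o  ∷ o  ∷ []) ∷
  (o  ∷ r  ∷ o  ∷ o  ∷ r  ∷ o  ∷ o  ∷ m2 ∷ o  ∷ o  ∷ p2 ∷ o  ∷ []) ∷
  (o  ∷ o  ∷ r  ∷ o  ∷ o  ∷ r  ∷ o  ∷ o  ∷ m2 ∷ o  ∷ o  ∷ p2 ∷ []) ∷
  (o  ∷ o  ∷ o  ∷ o  ∷ o  ∷ o  ∷ p2 ∷ o  ∷ o  ∷ o  ∷ p1 ∷ p1 ∷ []) ∷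
  (o  ∷ o  ∷ o  ∷ o  ∷ o  ∷ o  ∷ o  ∷ p2 ∷ o  ∷ p1 ∷ o  ∷ p1 ∷ []) ∷
  (o  ∷ o  ∷ o  ∷ o  ∷ o  ∷ o  ∷ o  ∷ o  ∷ p2 ∷ p1 ∷ p1 ∷ o  ∷ []) ∷
  []
  where
  o p1 m1 p2 m2 r : Exact
  o  = exact-integer {0ℝ}  (+ 0)      ≈-refl
  p1 = exact-integer {1ℝ}  (+ 1)      ≈-refl
  m1 = exact-integer { -1ℝ} ℤ.-[1+ 0 ] (pointwise λ _ → ≡.refl)
  p2 = exact-integer {2ℝ}  (+ 2)      (pointwise λ _ → ≡.refl)
  m2 = exact-integer { -2ℝ} ℤ.-[1+ 1 ] (pointwise λ _ → ≡.refl)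
  r  = exact {√2} (+ 0 +√2· + 1) (solve 1 (λ r → r := con (+ 0) :+ r :* con (+ 1)) ≈-refl √2)

Bᴷ : Fin 12 → Fin 12 → ℤ[√2]
Bᴷ i j = code (lookup (lookup B-table i) j)

B≈Bᴷ : ∀ i j → B i j ≈ ⟦ Bᴷ i j ⟧ᴷ
-- The rows of `B` are by evaluation `Vec.map (Vec.map value) B-table`, so two lookup laws replace
-- 144 cases.
B≈Bᴷ i j = ≈-trans (≈-reflexive (≡.trans
    (≡.cong (λ row → lookup row j) (lookup-map i (Vec.map value) B-table))
    (lookup-map j value (lookup B-table i))))
  (correct (lookup (lookup B-table i) j))

freePosition? : ∀ ((i , j) : Fin 12 × Fin 12) → Dec (i Fin.< j × Bᴷ i j ≡ 0ᴷ)
freePosition? (i , j) = (i Finₚ.<? j) ×-dec (Bᴷ i j ≟ᴷ 0ᴷ)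

-- In this order the integers met during the elimination stay small.
freePositions : List (Fin 12 × Fin 12)
freePositions = List.filter freePosition?
  (List.cartesianProductWith (λ j i → i , j)
    (List.reverse (List.allFin 12)) (List.reverse (List.allFin 12)))

Bᴷ-symmetric : ∀ i j → Bᴷ i j ≡ Bᴷ j i
Bᴷ-symmetric = from-yes (all? λ i → all? λ j → Bᴷ i j ≟ᴷ Bᴷ j i)

Bᴷ-support : ∀ i j → i ≡ j ⊎ norm (Bᴷ i j) ≢ + 0 × Graph.Adj H i j ⊎ Bᴷ i j ≡ 0ᴷ × ¬ Graph.Adj H i j
Bᴷ-support = from-yes (all? λ i → all? λ j → (i ≟ j)
  ⊎-dec (¬? (norm (Bᴷ i j) ℤₚ.≟ + 0) ×-dec Adj? i j) ⊎-dec ((Bᴷ i j ≟ᴷ 0ᴷ) ×-dec ¬? (Adj? i j)))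

B≉0 : ∀ {i j} → norm (Bᴷ i j) ≢ + 0 → B i j ≉ 0ℝ
B≉0 {i} {j} norm≢0 b≈0 = norm≢0⇒≉0 (Bᴷ i j) norm≢0 (≈-trans (≈-sym (B≈Bᴷ i j)) b≈0)

B≈0 : ∀ {i j} → Bᴷ i j ≡ 0ᴷ → B i j ≈ 0ℝ
B≈0 {i} {j} b≡0 = ≈-trans (B≈Bᴷ i j) (≈-trans (≈-reflexive (≡.cong ⟦_⟧ᴷ b≡0)) ⟦0⟧≈0)

B-symmetric : IsSymmetric B
B-symmetric i j = ≈-trans (B≈Bᴷ i j)
  (≈-trans (≈-reflexive (≡.cong ⟦_⟧ᴷ (Bᴷ-symmetric i j))) (≈-sym (B≈Bᴷ j i)))

B∈𝒮H : B ∈𝒮 H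
B∈𝒮H = record { symmetric = B-symmetric ; support = λ i j i≢j → support i≢j (Bᴷ-support i j) }
  where
  support : ∀ {i j} → i ≢ j → i ≡ j ⊎ norm (Bᴷ i j) ≢ + 0 × Graph.Adj H i j ⊎ Bᴷ i j ≡ 0ᴷ × ¬ Graph.Adj H i j →
    B i j ≉ 0ℝ ⇔ Graph.Adj H i j
  support         i≢j (inj₁ i≡j)                    = contradiction i≡j i≢j
  support {i} {j} i≢j (inj₂ (inj₁ (norm≢0 , i~j)))  = mk⇔ (λ _ → i~j) (λ _ → B≉0 {i} {j} norm≢0)
  support {i} {j} i≢j (inj₂ (inj₂ (b≡0 , i≁j)))     =
    mk⇔ (λ b≉0 → contradiction (B≈0 {i} {j} b≡0) b≉0) (λ i~j → contradiction i~j i≁j)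

∈-freePositions : ∀ {i j} → i Fin.< j → Bᴷ i j ≡ 0ᴷ → (i , j) ∈ freePositions
∈-freePositions {i} {j} i<j b≡0 = ∈-filter⁺ freePosition?
  (∈-cartesianProductWith⁺ (λ j i → i , j) (Anyₚ.reverse⁺ (∈-allFin j)) (Anyₚ.reverse⁺ (∈-allFin i)))
  (i<j , b≡0)

freePositions-complete : ∀ i j → i ≡ j ⊎ B i j ≉ 0ℝ ⊎ (i , j) ∈ freePositions ⊎ (j , i) ∈ freePositions
freePositions-complete i j = cases (Bᴷ-support i j)
  where
  cases : i ≡ j ⊎ norm (Bᴷ i j) ≢ + 0 × Graph.Adj H i j ⊎ Bᴷ i j ≡ 0ᴷ × ¬ Graph.Adj H i j →
    i ≡ j ⊎ B i j ≉ 0ℝ ⊎ (i , j) ∈ freePositions ⊎ (j , i) ∈ freePositions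
  cases (inj₁ i≡j)                  = inj₁ i≡j
  cases (inj₂ (inj₁ (norm≢0 , _)))  = inj₂ (inj₁ (B≉0 {i} {j} norm≢0))
  cases (inj₂ (inj₂ (b≡0 , _)))     = order (Finₚ.<-cmp i j)
    where
    order : Tri (i Fin.< j) (i ≡ j) (j Fin.< i) →
      i ≡ j ⊎ B i j ≉ 0ℝ ⊎ (i , j) ∈ freePositions ⊎ (j , i) ∈ freePositions
    order (tri≈ _ i≡j _) = inj₁ i≡j
    order (tri< i<j _ _) = inj₂ (inj₂ (inj₁ (∈-freePositions i<j b≡0)))
    order (tri> _ _ j<i) = inj₂ (inj₂ (inj₂ (∈-freePositions j<i (≡.trans (Bᴷ-symmetric j i) b≡0))))

-- The system evaluated by `≡.refl` has 66 - 18 = 48 unknowns, the non-edges, and 67 equations: 66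
-- commutator entries and one trace.
SMP-B : SMP B
SMP-B = SMP-by-elimination B Bᴷ B≈Bᴷ freePositions freePositions-complete ≡.refl

private
  infix 9 +#_ -#_ +√_ -√_

  +#_ -#_ +√_ -√_ : ℕ → ℤ[√2]
  +# n = + n +√2· + 0
  -# n = ℤ.- + n +√2· + 0
  +√ n = + 0 +√2· + n
  -√ n = + 0 +√2· ℤ.- + n

-- The rotation of the hexagon, taken with 7 → 8 → 9 → 7 and 10 → 11 → 12 → 10, preserves `B` and
-- permutes these vectors cyclically. With D = 1 instead of 2 they would leave ℤ[√2], as 5√2/2 would
-- occur.
V₋₄ : Vec (Vec ℤ[√2] 12) 3
V₋₄ =
  (+# 2 ∷ 0ᴷ   ∷ 0ᴷ   ∷ +# 2 ∷ 0ᴷ   ∷ 0ᴷ   ∷ -√ 5 ∷ +√ 1 ∷ +√ 1 ∷ +√ 3 ∷ -√ 1 ∷ -√ 1 ∷ []) ∷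
  (0ᴷ   ∷ +# 2 ∷ 0ᴷ   ∷ 0ᴷ   ∷ +# 2 ∷ 0ᴷ   ∷ +√ 1 ∷ -√ 5 ∷ +√ 1 ∷ -√ 1 ∷ +√ 3 ∷ -√ 1 ∷ []) ∷
  (0ᴷ   ∷ 0ᴷ   ∷ +# 2 ∷ 0ᴷ   ∷ 0ᴷ   ∷ +# 2 ∷ +√ 1 ∷ +√ 1 ∷ -√ 5 ∷ -√ 1 ∷ -√ 1 ∷ +√ 3 ∷ []) ∷
  []

-- The first two vectors are eigenvectors of the 6-cycle for its adjacency eigenvalue 1. Their
-- antipodal entries are opposite, so they cancel at 7, 8 and 9.
V₀ : Vec (Vec ℤ[√2] 12) 5
V₀ =
  (+# 1 ∷ 0ᴷ   ∷ -# 1 ∷ -# 1 ∷ 0ᴷ   ∷ +# 1 ∷ 0ᴷ   ∷ 0ᴷ   ∷ 0ᴷ   ∷ 0ᴷ   ∷ 0ᴷ   ∷ 0ᴷ   ∷ []) ∷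
  (0ᴷ   ∷ +# 1 ∷ +# 1 ∷ 0ᴷ   ∷ -# 1 ∷ -# 1 ∷ 0ᴷ   ∷ 0ᴷ   ∷ 0ᴷ   ∷ 0ᴷ   ∷ 0ᴷ   ∷ 0ᴷ   ∷ []) ∷
  (0ᴷ   ∷ 0ᴷ   ∷ 0ᴷ   ∷ 0ᴷ   ∷ +√ 1 ∷ +√ 1 ∷ +# 1 ∷ 0ᴷ   ∷ 0ᴷ   ∷ +# 1 ∷ -# 1 ∷ -# 1 ∷ []) ∷
  (0ᴷ   ∷ 0ᴷ   ∷ +√ 1 ∷ +√ 1 ∷ 0ᴷ   ∷ 0ᴷ   ∷ 0ᴷ   ∷ +# 1 ∷ 0ᴷ   ∷ -# 1 ∷ +# 1 ∷ -# 1 ∷ []) ∷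
  (0ᴷ   ∷ 0ᴷ   ∷ 0ᴷ   ∷ +√ 1 ∷ +√ 1 ∷ 0ᴷ   ∷ 0ᴷ   ∷ 0ᴷ   ∷ +# 1 ∷ -# 1 ∷ -# 1 ∷ +# 1 ∷ []) ∷
  []

-- The alternating vector belongs to the adjacency eigenvalue -2 of the 6-cycle, and its antipodal
-- entries are again opposite. The scale D = 2 clears the fractions 1/2 and √2/2 of the other three.
V₃ : Vec (Vec ℤ[√2] 12) 4
V₃ =
  (+# 2 ∷ -# 2 ∷ +# 2 ∷ -# 2 ∷ +# 2 ∷ -# 2 ∷ 0ᴷ   ∷ 0ᴷ   ∷ 0ᴷ   ∷ 0ᴷ   ∷ 0ᴷ   ∷ 0ᴷ   ∷ []) ∷
  (0ᴷ   ∷ +√ 1 ∷ -√ 2 ∷ +√ 3 ∷ -√ 2 ∷ +√ 1 ∷ +# 2 ∷ 0ᴷ   ∷ 0ᴷ   ∷ +# 2 ∷ +# 1 ∷ +# 1 ∷ []) ∷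
  (0ᴷ   ∷ +√ 1 ∷ 0ᴷ   ∷ -√ 1 ∷ +√ 2 ∷ -√ 1 ∷ 0ᴷ   ∷ +# 2 ∷ 0ᴷ   ∷ +# 1 ∷ +# 2 ∷ +# 1 ∷ []) ∷
  (0ᴷ   ∷ -√ 1 ∷ +√ 2 ∷ -√ 1 ∷ 0ᴷ   ∷ +√ 1 ∷ 0ᴷ   ∷ 0ᴷ   ∷ +# 2 ∷ +# 1 ∷ +# 1 ∷ +# 2 ∷ []) ∷
  []

isEigen? : ∀ {d} μ (V : Vec (Vec ℤ[√2] 12) d) →
  Dec (∀ k i → sumᴷ (λ j → Bᴷ i j *ᴷ lookup (lookup V k) j) ≡ μ *ᴷ lookup (lookup V k) i)
isEigen? μ V = all? λ k → all? λ i →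
  sumᴷ (λ j → Bᴷ i j *ᴷ lookup (lookup V k) j) ≟ᴷ (μ *ᴷ lookup (lookup V k) i)

hasCoordinates? : ∀ {d} D (V : Vec (Vec ℤ[√2] 12) d) (f : Vec (Fin 12) d) →
  Dec (∀ k l → lookup (lookup V k) (lookup f l) ≡ (D +√2· + 0) *ᴷ Iᴷ l k)
hasCoordinates? D V f = all? λ k → all? λ l →
  lookup (lookup V k) (lookup f l) ≟ᴷ ((D +√2· + 0) *ᴷ Iᴷ l k)

dimension₋₄ : HasDimension (Eigenspace B -4ℝ) 3
dimension₋₄ = eigenspace-dimension B Bᴷ B≈Bᴷ (-# 4) (exact-constant (ℤ.- + 4) (pointwise λ _ → ≡.refl))
  (+ 2) (fromℚ ℚ.½) (pointwise λ _ → ≡.refl) (λ k → lookup (lookup V₋₄ k)) (lookup f)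
  (from-yes (isEigen? (-# 4) V₋₄)) (from-yes (hasCoordinates? (+ 2) V₋₄ f)) ≡.refl
  where
  f : Vec (Fin 12) 3
  f = 0F ∷ 1F ∷ 2F ∷ []

dimension₀ : HasDimension (Eigenspace B 0ℝ) 5
dimension₀ = eigenspace-dimension B Bᴷ B≈Bᴷ 0ᴷ (≈-sym ⟦0⟧≈0)
  (+ 1) 1ℝ (*-identityˡ 1ℝ) (λ k → lookup (lookup V₀ k)) (lookup f)
  (from-yes (isEigen? 0ᴷ V₀)) (from-yes (hasCoordinates? (+ 1) V₀ f)) ≡.refl
  where
  f : Vec (Fin 12) 5
  f = 0F ∷ 1F ∷ 6F ∷ 7F ∷ 8F ∷ []

dimension₃ : HasDimension (Eigenspace B 3ℝ) 4
dimension₃ = eigenspace-dimension B Bᴷ B≈Bᴷ (+# 3) (exact-constant (+ 3) (pointwise λ _ → ≡.refl))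
  (+ 2) (fromℚ ℚ.½) (pointwise λ _ → ≡.refl) (λ k → lookup (lookup V₃ k)) (lookup f)
  (from-yes (isEigen? (+# 3) V₃)) (from-yes (hasCoordinates? (+ 2) V₃ f)) ≡.refl
  where
  f : Vec (Fin 12) 4
  f = 0F ∷ 6F ∷ 7F ∷ 8F ∷ []

-- Exclusion of further eigenvalues

B-minimalPolynomial : ∀ i j → (Bᴷ ·ᴷ (Bᴷ ·ᴷ Bᴷ)) i j +ᴷ (Bᴷ ·ᴷ Bᴷ) i j ≡ (+# 12) *ᴷ Bᴷ i j
B-minimalPolynomial = from-yes (all? λ i → all? λ j →
  ((Bᴷ ·ᴷ (Bᴷ ·ᴷ Bᴷ)) i j +ᴷ (Bᴷ ·ᴷ Bᴷ) i j) ≟ᴷ ((+# 12) *ᴷ Bᴷ i j))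

-- That v is not the zero vector names no nonzero entry to cancel. So the polynomial value is
-- assumed nonzero and cancelled instead, from every entry of p(μ) v = p(B) v = 0 with p(t) = t³ +
-- t² - 12 t, which would make v vanish.
minimalPolynomial-annihilates : ∀ {μ} → IsEigenvalue B μ → (μ - -4ℝ) * (μ * (μ - 3ℝ)) ≈ 0ℝ
minimalPolynomial-annihilates {μ} (v , v≉0 , Bv) = ≈0-stable λ p≉0 → v≉0 λ i → *-cancel-≉0 p≉0 (begin
  (μ - -4ℝ) * (μ * (μ - 3ℝ)) * v i
    ≈⟨ *-congʳ (*-cong (+-congˡ (-‿cong (pointwise λ _ → ≡.refl)))
         (*-congˡ (+-congˡ (-‿cong (pointwise λ _ → ≡.refl))))) ⟩
  (μ - ι (ℤ.- + 4)) * (μ * (μ - ι (+ 3))) * v i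
    ≈⟨ solve 2 (λ m v → (m :- con (ℤ.- + 4)) :* (m :* (m :- con (+ 3))) :* v :=
         (m :* (m :* (m :* v)) :+ m :* (m :* v)) :- con (+ 12) :* (m :* v)) ≈-refl μ (v i) ⟩
  (μ * (μ * (μ * v i)) + μ * (μ * v i)) - ι (+ 12) * (μ * v i)
    ≈⟨ +-cong (+-cong (≈-sym (B³v i)) (≈-sym (B²v i))) (-‿cong (*-congˡ (≈-sym (Bv i)))) ⟩
  (((B · (B · B)) ∙ᵛ v) i + ((B · B) ∙ᵛ v) i) - ι (+ 12) * (B ∙ᵛ v) i
    ≈⟨ x≈y⇒x-y≈0 (identity i) ⟩
  0ℝ ∎)
  where
  μBv : ∀ c {w} → B ∙ᵛ w ≋ (λ i → c * w i) → B ∙ᵛ (B ∙ᵛ w) ≋ λ i → c * (c * w i)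
  μBv c {w} Bw i = ≈-trans (∙ᵛ-cong B Bw i) (≈-trans (∙ᵛ-scale B c w i) (*-congˡ (Bw i)))

  B²v : (B · B) ∙ᵛ v ≋ λ i → μ * (μ * v i)
  B²v i = ≈-trans (∙ᵛ-· B B v i) (μBv μ Bv i)

  B³v : (B · (B · B)) ∙ᵛ v ≋ λ i → μ * (μ * (μ * v i))
  B³v i = ≈-trans (∙ᵛ-· B (B · B) v i) (≈-trans (∙ᵛ-cong B B²v i)
    (≈-trans (∙ᵛ-scale B μ (λ i → μ * v i) i) (*-congˡ (≈-trans (∙ᵛ-scale B μ v i) (*-congˡ (Bv i))))))

  B² : ∀ i j → (B · B) i j ≈ ⟦ (Bᴷ ·ᴷ Bᴷ) i j ⟧ᴷ
  B² = ⟦⟧-· {P = B} {B} {Bᴷ} {Bᴷ} B≈Bᴷ B≈Bᴷ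

  B³ : ∀ i j → (B · (B · B)) i j ≈ ⟦ (Bᴷ ·ᴷ (Bᴷ ·ᴷ Bᴷ)) i j ⟧ᴷ
  B³ = ⟦⟧-· {P = B} {B · B} {Bᴷ} {Bᴷ ·ᴷ Bᴷ} B≈Bᴷ B²

  entries : ∀ i j → (B · (B · B)) i j + (B · B) i j ≈ ι (+ 12) * B i j
  entries i j = begin
    (B · (B · B)) i j + (B · B) i j
      ≈⟨ +-cong (B³ i j) (B² i j) ⟩
    ⟦ (Bᴷ ·ᴷ (Bᴷ ·ᴷ Bᴷ)) i j ⟧ᴷ + ⟦ (Bᴷ ·ᴷ Bᴷ) i j ⟧ᴷ
      ≈⟨ ⟦⟧-+ ((Bᴷ ·ᴷ (Bᴷ ·ᴷ Bᴷ)) i j) ((Bᴷ ·ᴷ Bᴷ) i j) ⟨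
    ⟦ (Bᴷ ·ᴷ (Bᴷ ·ᴷ Bᴷ)) i j +ᴷ (Bᴷ ·ᴷ Bᴷ) i j ⟧ᴷ
      ≈⟨ ≈-reflexive (≡.cong ⟦_⟧ᴷ (B-minimalPolynomial i j)) ⟩
    ⟦ (+# 12) *ᴷ Bᴷ i j ⟧ᴷ
      ≈⟨ ⟦⟧-* (+# 12) (Bᴷ i j) ⟩
    ⟦ +# 12 ⟧ᴷ * ⟦ Bᴷ i j ⟧ᴷ
      ≈⟨ *-cong (⟦⟧-integer (+ 12)) (≈-sym (B≈Bᴷ i j)) ⟩
    ι (+ 12) * B i j ∎

  identity : ∀ i → ((B · (B · B)) ∙ᵛ v) i + ((B · B) ∙ᵛ v) i ≈ ι (+ 12) * (B ∙ᵛ v) i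
  identity i = begin
    ((B · (B · B)) ∙ᵛ v) i + ((B · B) ∙ᵛ v) i
      ≈⟨ ∑-distrib-+ (λ j → (B · (B · B)) i j * v j) (λ j → (B · B) i j * v j) ⟨
    sum (λ j → (B · (B · B)) i j * v j + (B · B) i j * v j)
      ≈⟨ sum-cong-≋ (λ j → ≈-trans (≈-sym (distribʳ (v j) ((B · (B · B)) i j) ((B · B) i j)))
           (≈-trans (*-congʳ {v j} (entries i j)) (*-assoc (ι (+ 12)) (B i j) (v j)))) ⟩
    sum (λ j → ι (+ 12) * (B i j * v j))
      ≈⟨ *-distribˡ-sum (ι (+ 12)) (λ j → B i j * v j) ⟨
    ι (+ 12) * (B ∙ᵛ v) i ∎

spectrum : Vec ℝ 3
spectrum = -4ℝ ∷ 0ℝ ∷ 3ℝ ∷ []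

-- The factors μ + 4, μ and μ - 3 differ pairwise by 4, 3 and 7. The gap 4 decides that μ + 4 or μ
-- is apart from 0; after cancelling it, the gap 3 or 7 decides between the remaining two factors.
root-cases : ∀ μ → (μ - -4ℝ) * (μ * (μ - 3ℝ)) ≈ 0ℝ → ∃ λ i → μ ≈ lookup spectrum i
root-cases μ p≈0 = [ below , above ]′
  (apart-cotransitive (μ - -4ℝ) μ (apart-resp-≈ four (ι-apart (+ 4) λ ())))
  where
  four : ι (+ 4) ≈ (μ - -4ℝ) - μ
  four = ≈-trans (solve 1 (λ m → con (+ 4) := (m :- con (ℤ.- + 4)) :- m) ≈-refl μ)
    (+-congʳ (+-congˡ (-‿cong (pointwise λ _ → ≡.refl))))

  three : μ - (μ - 3ℝ) ≈ ι (+ 3)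
  three = ≈-trans (+-congˡ (-‿cong (+-congˡ (-‿cong (pointwise λ _ → ≡.refl)))))
    (solve 1 (λ m → m :- (m :- con (+ 3)) := con (+ 3)) ≈-refl μ)

  seven : (μ - -4ℝ) - (μ - 3ℝ) ≈ ι (+ 7)
  seven = ≈-trans (+-cong (+-congˡ (-‿cong (pointwise λ _ → ≡.refl)))
      (-‿cong (+-congˡ (-‿cong (pointwise λ _ → ≡.refl)))))
    (solve 1 (λ m → (m :- con (ℤ.- + 4)) :- (m :- con (+ 3)) := con (+ 7)) ≈-refl μ)

  below : Apart (μ - -4ℝ) → ∃ λ i → μ ≈ lookup spectrum i
  below apart = [ (λ μ≈0 → 1F , μ≈0) , (λ μ-3≈0 → 2F , x-y≈0⇒x≈y μ-3≈0) ]′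
    (product-zero three (ι-apart (+ 3) λ ()) (apart-* apart p≈0))

  above : Apart μ → ∃ λ i → μ ≈ lookup spectrum i
  above apart = [ (λ μ+4≈0 → 0F , x-y≈0⇒x≈y μ+4≈0) , (λ μ-3≈0 → 2F , x-y≈0⇒x≈y μ-3≈0) ]′
    (product-zero seven (ι-apart (+ 7) λ ()) (apart-* apart (≈-trans
      (solve 3 (λ a m b → m :* (a :* b) := a :* (m :* b)) ≈-refl (μ - -4ℝ) μ (μ - 3ℝ)) p≈0)))

B-eigenvalues : DistinctEigenvalues B spectrum multiplicities
B-eigenvalues = record
  { increasing   = λ {i} {j} → increasing i j
  ; eigenvalue   = λ
    { 0F → dimension⇒nonzero dimension₋₄
    ; 1F → dimension⇒nonzero dimension₀
    ; 2F → dimension⇒nonzero dimension₃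
    }
  ; exhaustive   = λ μ eigenvalue → root-cases μ (minimalPolynomial-annihilates eigenvalue)
  ; multiplicity = λ { 0F → dimension₋₄ ; 1F → dimension₀ ; 2F → dimension₃ }
  }
  where
  increasing : ∀ i j → i Fin.< j → lookup spectrum i < lookup spectrum j
  increasing 0F 1F _ = mk< ℚ.1ℚ (ℚₚ.positive⁻¹ ℚ.1ℚ) 0 λ n _ →
    from-yes (seq (lookup spectrum 0F) n ℚ.+ ℚ.1ℚ ℚₚ.≤? seq (lookup spectrum 1F) n)
  increasing 0F 2F _ = mk< ℚ.1ℚ (ℚₚ.positive⁻¹ ℚ.1ℚ) 0 λ n _ →
    from-yes (seq (lookup spectrum 0F) n ℚ.+ ℚ.1ℚ ℚₚ.≤? seq (lookup spectrum 2F) n)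
  increasing 1F 2F _ = mk< ℚ.1ℚ (ℚₚ.positive⁻¹ ℚ.1ℚ) 0 λ n _ →
    from-yes (seq (lookup spectrum 1F) n ℚ.+ ℚ.1ℚ ℚₚ.≤? seq (lookup spectrum 2F) n)
  increasing 0F 0F ()
  increasing 1F 0F ()
  increasing 1F 1F (ℕ.s≤s ())
  increasing 2F 0F ()
  increasing 2F 1F (ℕ.s≤s ())
  increasing 2F 2F (ℕ.s≤s (ℕ.s≤s ()))

proposition4p2 : (∀ (A : Matrix 12) → A ∈𝒮 H → HasMultiplicityList A (3 ∷ 5 ∷ 4 ∷ []) → ¬ SSP A) ×
    B ∈𝒮 H ×
    HasSpectrum B (-4ℝ ∷ -4ℝ ∷ -4ℝ ∷ 0ℝ ∷ 0ℝ ∷ 0ℝ ∷ 0ℝ ∷ 0ℝ ∷ 3ℝ ∷ 3ℝ ∷ 3ℝ ∷ 3ℝ ∷ []) ×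
    HasMultiplicityList B (3 ∷ 5 ∷ 4 ∷ []) ×
    SMP B
proposition4p2 = ¬SSP-H , B∈𝒮H
  -- Repeating each eigenvalue by its multiplicity evaluates to the listed spectrum in the same
  -- order, so the identity permutation suffices.
  , (3 , spectrum , multiplicities , B-eigenvalues , ↭-refl)
  , (spectrum , B-eigenvalues)
  , SMP-B
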